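{- Consider an instance of $F2\mid G=K_\ell\cup K_{n-\ell},\,p_{ij}\mid C_{\max}$ with job groups $A=\{J_1,\dots,J_\ell\}$ and $B=\{J_{\ell+1},\dots,J_n\}$. Set $P_A^1=\sum_{j\le\ell}p_{1j}$, $P_A^2=\sum_{j\le \ell}p_{2j}$, $P_B^1=\sum_{j>\ell}p_{1j}$ and $P_B^2=\sum_{j>\ell}p_{2j}$. Choose the ordered pair of groups $(X,Y)=(A,B)$ if $\min\{P_A^1,P_B^2\}\le\min\{P_B^1,P_A^2\}$, and $(X,Y)=(B,A)$ otherwise. Define the schedule $\pi$ as follows. Machine $M_1$ processes the jobs of $X$ consecutively in increasing index order starting at time $0$, and then the jobs of $Y$ consecutively in increasing index order. Machine $M_2$ processes the jobs of $X$ consecutively in increasing index order starting at time $P_X^1$. It then processes the jobs of $Y$ consecutively in increasing index order starting at time $P_X^1+\max\{P_X^2,P_Y^1\}$. Then $\pi$ is a feasible schedule with makespan $P_X^1+\max\{P_X^2,P_Y^1\}+P_Y^2\le\tfrac32 C^*_{\max}$, where $C^*_{\max}$ is the optimal makespan. Moreover, $\pi$ can be computed in $O(m)$ time, where $m$ is the number of edges of $G$.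
   Context: An instance of $F2\mid G=K_\ell\cup K_{n-\ell},\,p_{ij}\mid C_{\max}$ consists of $n$ jobs $J_1,\dots,J_n$ and two machines $M_1$ and $M_2$. Each job $J_j$ must be processed nonpreemptively first on $M_1$ for time $p_{1j}\ge 0$ and afterwards on $M_2$ for time $p_{2j}\ge 0$. Each machine processes at most one job at a time. The conflict graph $G$ is the disjoint union of a clique on $\{J_1,\dots,J_\ell\}$ and a clique on $\{J_{\ell+1},\dots,J_n\}$. Two jobs adjacent in $G$ may not be processed at the same time on different machines. The makespan is the completion time of the last operation. -}

module Defs where

open import Algebra.Bundles using (CommutativeRing)
import Algebra.Construct.NaturalChoice.Max as NaturalMax
import Algebra.Construct.NaturalChoice.Min as NaturalMin
import Algebra.Properties.Monoid.Sum as MonoidSum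
open import Algebra.Structures using (IsCommutativeRing)
open import Data.Bool.Base using (Bool; true; false; if_then_else_)
open import Data.Fin.Base as Fin using (Fin; toℕ; fromℕ<)
import Data.Fin.Properties as Fin
open import Data.List.Base using (List; filter; length; allFin; cartesianProduct)
open import Data.Nat.Base as ℕ using (ℕ; suc)
import Data.Nat.Properties as ℕ
open import Data.Product.Base using (Σ; ∃; _×_; _,_)
import Data.Vec.Functional as Vector
open import Level using (Level; _⊔_) renaming (suc to lsuc)
open import Relation.Binary.Bundles using (DecTotalOrder)
open import Relation.Binary.Core using (Rel)
open import Relation.Binary.Definitions using (DecidableEquality)
open import Relation.Binary.PropositionalEquality using (_≡_; _≢_; refl)
open import Relation.Binary.Structures using (IsDecTotalOrder)
import Relation.Binary.Construct.NonStrictToStrict as ToStrict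
open import Relation.Nullary using (¬_; Dec; yes; no; does; _×-dec_; ¬?)
open import Relation.Unary using (Pred; Decidable)

-- Ordered fields stand in for the real numbers, which are not available in
-- the library; ℚ is an example.  The value of 0# ⁻¹ is unspecified.

record OrderedField (a ℓ : Level) : Set (lsuc (a ⊔ ℓ)) where
  infix  8 -_ _⁻¹
  infixl 7 _*_
  infixl 6 _+_
  infix  4 _≤_
  field
    Carrier : Set a
    _≤_     : Rel Carrier ℓ
    _+_ _*_ : Carrier → Carrier → Carrier
    -_ _⁻¹  : Carrier → Carrier
    0# 1#   : Carrier
    isCommutativeRing : IsCommutativeRing _≡_ _+_ _*_ -_ 0# 1#
    isDecTotalOrder   : IsDecTotalOrder _≡_ _≤_
    0#≢1#     : 0# ≢ 1#
    ⁻¹-inverseʳ : ∀ {x} → x ≢ 0# → x * x ⁻¹ ≡ 1#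
    +-monoʳ-≤ : ∀ x {y z} → y ≤ z → x + y ≤ x + z
    *-nonNeg  : ∀ {x y} → 0# ≤ x → 0# ≤ y → 0# ≤ x * y

  commutativeRing : CommutativeRing a a
  commutativeRing = record { isCommutativeRing = isCommutativeRing }

  decTotalOrder : DecTotalOrder a a ℓ
  decTotalOrder = record { isDecTotalOrder = isDecTotalOrder }

  open DecTotalOrder decTotalOrder public using (_≤?_; totalOrder)
  open ToStrict _≡_ _≤_ public using (_<_)
  open NaturalMax totalOrder public using () renaming (_⊔_ to max)
  open NaturalMin totalOrder public using () renaming (_⊓_ to min)
  open MonoidSum (CommutativeRing.+-monoid commutativeRing) public using (sum)

  3/2 : Carrier
  3/2 = (1# + 1# + 1#) * (1# + 1#) ⁻¹

data Machine : Set where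
  M₁ M₂ : Machine

data Group : Set where
  A B : Group

_≟ᴳ_ : DecidableEquality Group
A ≟ᴳ A = yes refl
A ≟ᴳ B = no λ ()
B ≟ᴳ A = no λ ()
B ≟ᴳ B = yes refl

_∈O_ : ∀ {x} {X : Set x} → (X → ℕ) → (X → ℕ) → Set x
f ∈O g = ∃ λ c → ∃ λ m₀ → ∀ x → m₀ ℕ.≤ g x → f x ℕ.≤ c ℕ.* g x

-- Programs for a unit-cost random access machine.  Indices are natural
-- numbers and data are field elements.  A program has no access to field
-- elements other than through the instructions below.  Index registers, data
-- registers and arrays of data are each named by a natural number.

data Test : Set where
  _<ᴵ_ : (x y : ℕ) → Test              -- compares index registers
  _≤ᴰ_ : (u v : ℕ) → Test              -- compares data registers

data Program : Set where
  constᴵ          : (x k : ℕ) → Program      -- x := k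
  addᴵ subᴵ       : (x y z : ℕ) → Program    -- x := y + z,  x := y ∸ z
  addᴰ subᴰ       : (u v w : ℕ) → Program    -- u := v + w,  u := v - w
  load            : (u a x : ℕ) → Program    -- u := a[x]
  store           : (a x u : ℕ) → Program    -- a[x] := u
  _︔_             : Program → Program → Program
  ifᵀ_then_else_  : Test → Program → Program → Program
  while_loop_     : Test → Program → Program

infixr 5 _︔_

_[_↦_] : ∀ {a} {V : Set a} → (ℕ → V) → ℕ → V → (ℕ → V)
(f [ x ↦ v ]) y = if does (y ℕ.≟ x) then v else f y

module FlowShop {a ℓ : Level} (F : OrderedField a ℓ) where

  open OrderedField F

  -- Job J_{j+1} is represented by j : Fin n.

  record Instance : Set (a ⊔ ℓ) where
    field
      n      : ℕ
      l      : ℕ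
      l≤n    : l ℕ.≤ n
      p      : Machine → Fin n → Carrier
      p-nonNeg : ∀ i j → 0# ≤ p i j

    group : Fin n → Group
    group j = if does (toℕ j ℕ.<? l) then A else B

    Adjacent : Fin n → Fin n → Set
    Adjacent j k = j ≢ k × group j ≡ group k

    adjacent? : ∀ j k → Dec (Adjacent j k)
    adjacent? j k = ¬? (j Fin.≟ k) ×-dec (group j ≟ᴳ group k)

    edges : List (Fin n × Fin n)
    edges = filter (λ (j , k) → (j Fin.<? k) ×-dec adjacent? j k)
                   (cartesianProduct (allFin n) (allFin n))

    sumOver : ∀ {r} {R : Pred (Fin n) r} → Decidable R → (Fin n → Carrier) → Carrier
    sumOver R? f = sum λ j → if does (R? j) then f j else 0#

    P : Group → Machine → Carrier
    P g i = sumOver (λ j → group j ≟ᴳ g) (p i)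

  edgeCount : Instance → ℕ
  edgeCount I = length (Instance.edges I)

  module _ (I : Instance) where
    open Instance I

    -- A schedule assigns a start time to every operation.
    Schedule : Set a
    Schedule = Machine → Fin n → Carrier

    completion : Schedule → Machine → Fin n → Carrier
    completion S i j = S i j + p i j

    -- An operation occupies a half-open interval, so an operation of length
    -- zero is never in process.
    InProcess : Schedule → Machine → Fin n → Carrier → Set (a ⊔ ℓ)
    InProcess S i j t = S i j ≤ t × t < completion S i j

    record Feasible (S : Schedule) : Set (a ⊔ ℓ) where
      field
        start-nonNeg : ∀ i j → 0# ≤ S i j
        flow         : ∀ j → completion S M₁ j ≤ S M₂ j
        machine      : ∀ i j k t → j ≢ k →
                       ¬ (InProcess S i j t × InProcess S i k t)
        conflict     : ∀ j k t → Adjacent j k →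
                       ¬ (InProcess S M₁ j t × InProcess S M₂ k t)

    -- The makespan of the empty schedule is 0#.
    makespan : Schedule → Carrier
    makespan S = Vector.foldr max 0# λ j → max (completion S M₁ j) (completion S M₂ j)

    IsOptimalMakespan : Carrier → Set (a ⊔ ℓ)
    IsOptimalMakespan C =
      (∃ λ S → Feasible S × makespan S ≡ C) × (∀ S → Feasible S → C ≤ makespan S)

    groupOrder : Group × Group
    groupOrder =
      if does (min (P A M₁) (P B M₂) ≤? min (P B M₁) (P A M₂))
      then (A , B) else (B , A)

    blockStart : Machine → Group → Carrier
    blockStart i g with groupOrder
    ... | X , Y with i | does (g ≟ᴳ X)
    ...   | M₁ | true  = 0#
    ...   | M₁ | false = P X M₁
    ...   | M₂ | true  = P X M₁
    ...   | M₂ | false = P X M₁ + max (P X M₂) (P Y M₁)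

    π : Schedule
    π i j = blockStart i (group j)
          + sumOver (λ k → (k Fin.<? j) ×-dec (group k ≟ᴳ group j)) (p i)

  -- Execution of programs.

  record State : Set a where
    constructor state
    field
      idx : ℕ → ℕ
      dat : ℕ → Carrier
      arr : ℕ → ℕ → Carrier

  test : Test → State → Bool
  test (x <ᴵ y) (state idx _ _) = does (idx x ℕ.<? idx y)
  test (u ≤ᴰ v) (state _ dat _) = does (dat u ≤? dat v)

  -- Exec c s s′ t: started in s, the program c halts in s′ after t steps.
  data Exec : Program → State → State → ℕ → Set a where
    constᴵ : ∀ {x k idx dat arr} →
      Exec (constᴵ x k) (state idx dat arr) (state (idx [ x ↦ k ]) dat arr) 1
    addᴵ : ∀ {x y z idx dat arr} →
      Exec (addᴵ x y z) (state idx dat arr)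
           (state (idx [ x ↦ idx y ℕ.+ idx z ]) dat arr) 1
    subᴵ : ∀ {x y z idx dat arr} →
      Exec (subᴵ x y z) (state idx dat arr)
           (state (idx [ x ↦ idx y ℕ.∸ idx z ]) dat arr) 1
    addᴰ : ∀ {u v w idx dat arr} →
      Exec (addᴰ u v w) (state idx dat arr)
           (state idx (dat [ u ↦ dat v + dat w ]) arr) 1
    subᴰ : ∀ {u v w idx dat arr} →
      Exec (subᴰ u v w) (state idx dat arr)
           (state idx (dat [ u ↦ dat v + (- dat w) ]) arr) 1
    load : ∀ {u b x idx dat arr} →
      Exec (load u b x) (state idx dat arr)
           (state idx (dat [ u ↦ arr b (idx x) ]) arr) 1
    store : ∀ {b x u idx dat arr} →
      Exec (store b x u) (state idx dat arr)
           (state idx dat (arr [ b ↦ arr b [ idx x ↦ dat u ] ])) 1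
    seq : ∀ {c d s s′ s″ t t′} →
      Exec c s s′ t → Exec d s′ s″ t′ → Exec (c ︔ d) s s″ (t ℕ.+ t′)
    if-true : ∀ {b c d s s′ t} → test b s ≡ true →
      Exec c s s′ t → Exec (ifᵀ b then c else d) s s′ (suc t)
    if-false : ∀ {b c d s s′ t} → test b s ≡ false →
      Exec d s s′ t → Exec (ifᵀ b then c else d) s s′ (suc t)
    while-true : ∀ {b c s s′ s″ t t′} → test b s ≡ true →
      Exec c s s′ t → Exec (while b loop c) s′ s″ t′ →
      Exec (while b loop c) s s″ (suc (t ℕ.+ t′))
    while-false : ∀ {b c s} → test b s ≡ false →
      Exec (while b loop c) s s 1

  module _ (I : Instance) where
    open Instance I

    -- Input: n and l in index registers 0 and 1, and the processing times on
    -- M₁ and M₂ in arrays 0 and 1.  Everything else is zero.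
    times : Machine → ℕ → Carrier
    times i k with k ℕ.<? n
    ... | yes k<n = p i (fromℕ< k<n)
    ... | no  _   = 0#

    input : State
    input = state idx (λ _ → 0#) arr
      where
      idx : ℕ → ℕ
      idx 0 = n
      idx 1 = l
      idx _ = 0

      arr : ℕ → ℕ → Carrier
      arr 0 = times M₁
      arr 1 = times M₂
      arr _ = λ _ → 0#

    -- Output: the start times on M₁ and M₂ in arrays 2 and 3.
    Outputs : Program → Schedule I → ℕ → Set a
    Outputs c S t = ∃ λ s → Exec c input s t ×
      (∀ j → State.arr s 2 (toℕ j) ≡ S M₁ j × State.arr s 3 (toℕ j) ≡ S M₂ j)

  ComputableInTimeO : (∀ I → Schedule I) → (Instance → ℕ) → Set (a ⊔ ℓ)
  ComputableInTimeO S f =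
    ∃ λ c → Σ (Instance → ℕ) λ time → (∀ I → Outputs I c (S I) (time I)) × time ∈O f

{-# OPTIONS --safe #-}
-- Let T be the makespan of a feasible schedule.  Operations that pairwise
-- exclude each other have total length at most T; applied to one machine, and
-- to both machines within one group, this gives P_A^i + P_B^i ≤ T and
-- P_g^1 + P_g^2 ≤ T.  Hence C = P_X^1 + max(P_X^2, P_Y^1) + P_Y^2 is at most
-- T + P_X^1 and at most T + P_Y^2.  The choice of (X, Y) makes
-- μ = min(P_X^1, P_Y^2) at most both P_X^1 and P_X^2, so 2 μ ≤ T and
-- C ≤ T + μ ≤ 3/2 T.
--
-- For the running time, each group is an interval of indices, so π consists of
-- prefix sums and is computed in O(n) steps; since two cliques on n vertices
-- have at least n - 2 edges, this is O(m).
module Submission where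

open import Defs
open import Algebra.Bundles using (CommutativeMonoid; CommutativeRing)
import Algebra.Construct.NaturalChoice.Max as NaturalMax
import Algebra.Construct.NaturalChoice.Min as NaturalMin
import Algebra.Construct.NaturalChoice.MinMaxOp as MinMaxOp
import Algebra.Properties.CommutativeMonoid.Sum as CommutativeMonoidSum
import Algebra.Properties.CommutativeSemigroup as CommutativeSemigroup
import Algebra.Properties.Ring as RingProperties
import Algebra.Solver.CommutativeMonoid as CommutativeMonoidSolver
open import Data.Bool.Base using (true; false; if_then_else_)
open import Data.Fin.Base as Fin using (Fin; zero; suc; toℕ; fromℕ<)
import Data.Fin.Properties as Fin
open import Data.List.Base using (List; []; _∷_; _++_; foldr; lookup; tabulate)
open import Data.List.Membership.Propositional using (_∈_)
open import Data.List.Membership.Propositional.Properties using (∈-allFin; ∈-cartesianProduct⁺; ∈-filter⁺)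
open import Data.List.Relation.Unary.All using (All; []; _∷_)
import Data.List.Relation.Unary.All.Properties as All
open import Data.List.Relation.Unary.AllPairs using (AllPairs; []; _∷_)
import Data.List.Relation.Unary.AllPairs.Properties as AllPairs
import Data.List.Relation.Unary.Any as Any
open import Data.List.Relation.Unary.Any.Properties using (lookup-index)
open import Data.Nat.Base as ℕ using (ℕ; zero; suc; z≤n; s≤s)
import Data.Nat.Properties as ℕ
open import Data.Nat.Solver using (module +-*-Solver)
open import Data.Product.Base using (∃; _×_; _,_; proj₁; proj₂)
open import Data.Sum.Base using (_⊎_; inj₁; inj₂; swap)
import Data.Vec.Functional as Vector
open import Function.Base using (_∘_; case_of_)
open import Level using (Level; _⊔_)
open import Relation.Binary.Bundles using (DecTotalOrder)
open import Relation.Binary.Definitions using (tri<; tri≈; tri>)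
import Relation.Binary.Reasoning.PartialOrder as PartialOrderReasoning
open import Relation.Binary.PropositionalEquality using (_≡_; _≢_; refl; sym; trans; cong; cong₂; subst; subst₂;
  module ≡-Reasoning)
open import Relation.Nullary using (¬_; Dec; yes; no; does; _×-dec_; contradiction)
open import Relation.Nullary.Decidable using (dec-true; dec-false)
open import Relation.Unary using (Pred; Decidable)

-- Zero-length operations are never in process, so exclusion says nothing about their position, and
-- the intervals of a schedule need not be linearly ordered. Total length is therefore bounded
-- without sorting: a positive interval cuts a time window in two, every other positive interval
-- inside the window falls into one part, and induction on the list applies to both parts. The sums
-- in the definition of `π` filter all jobs, while the program accumulates along an array. Both are
-- compared with `rangeSum`, a sum over consecutive indices. The group order depends on the loads,
-- which are known only after all jobs have been read; hence the program makes two sweeps with the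
-- same code. The running time is positive even for an edgeless graph, so the bound in m is claimed
-- from m = 1 on.

module OrderedFieldProperties {a ℓ : Level} (F : OrderedField a ℓ) where
  open OrderedField F
  open DecTotalOrder decTotalOrder public using (_≟_)
    renaming (refl to ≤-refl; reflexive to ≤-reflexive; trans to ≤-trans;
              antisym to ≤-antisym; total to ≤-total)
  open MinMaxOp (NaturalMin.minOperator totalOrder) (NaturalMax.maxOperator totalOrder) public
    using ()
    renaming (x⊓y≤x to min≤ˡ; x⊓y≤y to min≤ʳ; x≤x⊔y to max≥ˡ; x≤y⊔x to max≥ʳ; ⊔-lub to max-lub)
  open CommutativeRing commutativeRing public
    using (+-comm; +-assoc; +-identityˡ; +-identityʳ; *-identityˡ; *-identityʳ;
           -‿inverseˡ; distribˡ; distribʳ; +-commutativeMonoid; ring)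
  open CommutativeMonoidSum +-commutativeMonoid public using (∑-distrib-+; sum-cong-≗; sum-replicate-zero)
  open CommutativeSemigroup (CommutativeMonoid.commutativeSemigroup +-commutativeMonoid) public using (interchange)
  module +-Solver = CommutativeMonoidSolver +-commutativeMonoid
  module ≤-Reasoning = PartialOrderReasoning (DecTotalOrder.poset decTotalOrder)

  -- Arithmetic in an ordered field

  ≰⇒≥ : ∀ {x y} → ¬ x ≤ y → y ≤ x
  ≰⇒≥ {x} {y} x≰y with ≤-total y x
  ... | inj₁ y≤x = y≤x
  ... | inj₂ x≤y = contradiction x≤y x≰y

  +-monoˡ-≤ : ∀ x {y z} → y ≤ z → y + x ≤ z + x
  +-monoˡ-≤ x {y} {z} y≤z = subst₂ _≤_ (+-comm x y) (+-comm x z) (+-monoʳ-≤ x y≤z)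

  +-mono-≤ : ∀ {w x y z} → w ≤ x → y ≤ z → w + y ≤ x + z
  +-mono-≤ {x = x} {y} w≤x y≤z = ≤-trans (+-monoˡ-≤ y w≤x) (+-monoʳ-≤ x y≤z)

  x≤x+y : ∀ x {y} → 0# ≤ y → x ≤ x + y
  x≤x+y x {y} 0≤y = subst (_≤ x + y) (+-identityʳ x) (+-monoʳ-≤ x 0≤y)

  +-nonNeg : ∀ {x y} → 0# ≤ x → 0# ≤ y → 0# ≤ x + y
  +-nonNeg {x} 0≤x 0≤y = ≤-trans 0≤x (x≤x+y x 0≤y)

  +-cancelˡ : ∀ x {y z} → x + y ≡ x + z → y ≡ z
  +-cancelˡ x {y} {z} eq = begin
    y               ≡⟨ cancel y ⟨
    - x + (x + y)   ≡⟨ cong (- x +_) eq ⟩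
    - x + (x + z)   ≡⟨ cancel z ⟩
    z               ∎
    where
    open ≡-Reasoning
    cancel : ∀ w → - x + (x + w) ≡ w
    cancel w = trans (sym (+-assoc _ _ _)) (trans (cong (_+ w) (-‿inverseˡ x)) (+-identityˡ w))

  -- If `y ≤ x`, then `x + x ≤ y + y ≤ x + y ≤ x + x`, so cancellation gives `x ≡ y`. The ratio can
  -- thus be compared after doubling, without order properties of inverses.
  doubling-reflects-≤ : ∀ {x y} → x + x ≤ y + y → x ≤ y
  doubling-reflects-≤ {x} {y} 2x≤2y with ≤-total x y
  ... | inj₁ x≤y = x≤y
  ... | inj₂ y≤x = ≤-reflexive (+-cancelˡ x
    (≤-antisym (≤-trans 2x≤2y (+-monoˡ-≤ y y≤x)) (+-monoʳ-≤ x y≤x)))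

  -- If `1# ≤ 0#`, then `- 1#` is nonnegative, and so is its square, which is `1#`.
  0≤1 : 0# ≤ 1#
  0≤1 with ≤-total 0# 1#
  ... | inj₁ 0≤1 = 0≤1
  ... | inj₂ 1≤0 = subst (0# ≤_) eq (*-nonNeg 0≤-1 0≤-1)
    where
    open RingProperties ring using (-‿distribˡ-*; -‿involutive)
    0≤-1 : 0# ≤ - 1#
    0≤-1 = subst₂ _≤_ (-‿inverseˡ 1#) (+-identityʳ _) (+-monoʳ-≤ (- 1#) 1≤0)
    eq : - 1# * - 1# ≡ 1#
    eq = trans (sym (-‿distribˡ-* 1# (- 1#))) (trans (cong -_ (*-identityˡ _)) (-‿involutive 1#))

  -- Needed because the inverse in `3/2` obeys its law only at a nonzero argument. If two vanished,
  -- `0# ≤ 1# ≤ 1# + 1#` would force `0# ≡ 1#`.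
  2≢0 : 1# + 1# ≢ 0#
  2≢0 eq = 0#≢1# (≤-antisym 0≤1 (subst (1# ≤_) eq (x≤x+y 1# 0≤1)))

  double-3/2 : ∀ x → 3/2 * x + 3/2 * x ≡ x + x + x
  double-3/2 x = begin
    3/2 * x + 3/2 * x           ≡⟨ distribʳ x 3/2 3/2 ⟨
    (3/2 + 3/2) * x             ≡⟨ cong (_* x) double ⟩
    (1# + 1# + 1#) * x          ≡⟨ distribʳ x (1# + 1#) 1# ⟩
    (1# + 1#) * x + 1# * x      ≡⟨ cong (_+ 1# * x) (distribʳ x 1# 1#) ⟩
    1# * x + 1# * x + 1# * x    ≡⟨ cong (λ y → y + y + y) (*-identityˡ x) ⟩
    x + x + x                   ∎
    where
    open ≡-Reasoning
    half : Carrier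
    half = (1# + 1#) ⁻¹
    double : 3/2 + 3/2 ≡ 1# + 1# + 1#
    double = begin
      3/2 + 3/2                               ≡⟨ distribˡ (1# + 1# + 1#) half half ⟨
      (1# + 1# + 1#) * (half + half)          ≡⟨ cong (λ y → (1# + 1# + 1#) * (y + y)) (*-identityˡ half) ⟨
      (1# + 1# + 1#) * (1# * half + 1# * half) ≡⟨ cong ((1# + 1# + 1#) *_) (distribʳ half 1# 1#) ⟨
      (1# + 1# + 1#) * ((1# + 1#) * half)     ≡⟨ cong ((1# + 1# + 1#) *_) (⁻¹-inverseʳ 2≢0) ⟩
      (1# + 1# + 1#) * 1#                     ≡⟨ *-identityʳ _ ⟩
      1# + 1# + 1#                            ∎

  ≤-3/2 : ∀ {c m x} → c ≤ x + m → m + m ≤ x → c ≤ 3/2 * x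
  ≤-3/2 {c} {m} {x} c≤x+m 2m≤x = doubling-reflects-≤ (begin
    c + c               ≤⟨ +-mono-≤ c≤x+m c≤x+m ⟩
    (x + m) + (x + m)   ≡⟨ interchange x m x m ⟩
    (x + x) + (m + m)   ≤⟨ +-monoʳ-≤ (x + x) 2m≤x ⟩
    x + x + x           ≡⟨ double-3/2 x ⟨
    3/2 * x + 3/2 * x   ∎)
    where open ≤-Reasoning

  -- `min` branches on totality of the order, programs on `_≤?_`; this lemma and its three
  -- companions translate. Where totality picks the other argument, antisymmetry makes the two
  -- equal.
  min-≤⇒≡ : ∀ {x y} → x ≤ y → min x y ≡ x
  min-≤⇒≡ {x} {y} x≤y with ≤-total x y
  ... | inj₁ _   = refl
  ... | inj₂ y≤x = ≤-antisym y≤x x≤y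

  min-≥⇒≡ : ∀ {x y} → y ≤ x → min x y ≡ y
  min-≥⇒≡ {x} {y} y≤x with ≤-total x y
  ... | inj₁ x≤y = ≤-antisym x≤y y≤x
  ... | inj₂ _   = refl

  max-≤⇒≡ : ∀ {x y} → x ≤ y → max x y ≡ y
  max-≤⇒≡ {x} {y} x≤y = ≤-antisym (max-lub x≤y ≤-refl) (max≥ʳ x y)

  max-≥⇒≡ : ∀ {x y} → y ≤ x → max x y ≡ x
  max-≥⇒≡ {x} {y} y≤x = ≤-antisym (max-lub ≤-refl y≤x) (max≥ˡ x y)

  +-min-glb : ∀ {x y z u} → u ≤ z + x → u ≤ z + y → u ≤ z + min x y
  +-min-glb {x} {y} u≤z+x u≤z+y with ≤-total x y
  ... | inj₁ _ = u≤z+x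
  ... | inj₂ _ = u≤z+y

  +-max-lubˡ : ∀ {x y z u} → z + x ≤ u → z + y ≤ u → z + max x y ≤ u
  +-max-lubˡ {x} {y} z+x≤u z+y≤u with ≤-total x y
  ... | inj₁ x≤y = subst (λ v → _ + v ≤ _) (sym (max-≤⇒≡ x≤y)) z+y≤u
  ... | inj₂ y≤x = subst (λ v → _ + v ≤ _) (sym (max-≥⇒≡ y≤x)) z+x≤u

  +-max-lubʳ : ∀ {x y z u} → x + z ≤ u → y + z ≤ u → max x y + z ≤ u
  +-max-lubʳ {x} {y} {z} {u} x+z≤u y+z≤u = subst (_≤ u) (+-comm z (max x y))
    (+-max-lubˡ (subst (_≤ u) (+-comm x z) x+z≤u) (subst (_≤ u) (+-comm y z) y+z≤u))

  foldr-max-≥0 : ∀ {n} (f : Fin n → Carrier) → 0# ≤ Vector.foldr max 0# f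
  foldr-max-≥0 {zero}  f = ≤-refl
  foldr-max-≥0 {suc n} f = ≤-trans (foldr-max-≥0 (f ∘ suc)) (max≥ʳ _ _)

  foldr-max-upper : ∀ {n} (f : Fin n → Carrier) j → f j ≤ Vector.foldr max 0# f
  foldr-max-upper f zero    = max≥ˡ _ _
  foldr-max-upper f (suc j) = ≤-trans (foldr-max-upper (f ∘ suc) j) (max≥ʳ _ _)

  foldr-max-lub : ∀ {n} (f : Fin n → Carrier) {u} → 0# ≤ u → (∀ j → f j ≤ u) → Vector.foldr max 0# f ≤ u
  foldr-max-lub {zero}  f 0≤u f≤u = 0≤u
  foldr-max-lub {suc n} f 0≤u f≤u = max-lub (f≤u zero) (foldr-max-lub (f ∘ suc) 0≤u (f≤u ∘ suc))

  -- Total length of pairwise disjoint intervals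

  Interval : Set a
  Interval = Carrier × Carrier

  _∈I_ : Carrier → Interval → Set (a ⊔ ℓ)
  t ∈I (s , q) = s ≤ t × t < s + q

  Disjoint : Interval → Interval → Set (a ⊔ ℓ)
  Disjoint I J = ∀ t → ¬ (t ∈I I × t ∈I J)

  Within : Carrier → Carrier → Interval → Set ℓ
  Within b e (s , q) = b ≤ s × s + q ≤ e

  within? : ∀ b e I → Dec (Within b e I)
  within? b e (s , q) = (b ≤? s) ×-dec (s + q ≤? e)

  NonNegLength : Interval → Set ℓ
  NonNegLength (_ , q) = 0# ≤ q

  ∈I-zeroLength : ∀ {s t} → ¬ t ∈I (s , 0#)
  ∈I-zeroLength {s} (s≤t , t≤s+0 , t≢s+0) =
    t≢s+0 (≤-antisym t≤s+0 (subst (_≤ _) (sym (+-identityʳ s)) s≤t))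

  -- An interval that merely overlaps the window counts zero rather than the length of the overlap.
  -- This suffices because the initial window contains all intervals.
  weight : Carrier → Carrier → Interval → Carrier
  weight b e I = if does (within? b e I) then proj₂ I else 0#

  weightSum : Carrier → Carrier → List Interval → Carrier
  weightSum b e = foldr (λ I → weight b e I +_) 0#

  weight-within : ∀ {b e} I → Within b e I → weight b e I ≡ proj₂ I
  weight-within {b} {e} I I⊆ with b ≤? proj₁ I | proj₁ I + proj₂ I ≤? e
  ... | yes _  | yes _  = refl
  ... | yes _  | no ¬q  = contradiction (proj₂ I⊆) ¬q
  ... | no ¬p  | _      = contradiction (proj₁ I⊆) ¬p

  weight-cases : ∀ b e I → weight b e I ≡ 0# ⊎ Within b e I
  weight-cases b e I with b ≤? proj₁ I | proj₁ I + proj₂ I ≤? e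
  ... | yes p | yes q = inj₂ (p , q)
  ... | yes p | no ¬q = inj₁ refl
  ... | no ¬p | _     = inj₁ refl

  weight-nonNeg : ∀ b e I → NonNegLength I → 0# ≤ weight b e I
  weight-nonNeg b e I 0≤q with weight-cases b e I
  ... | inj₁ ≡0 = ≤-reflexive (sym ≡0)
  ... | inj₂ I⊆ = subst (0# ≤_) (sym (weight-within I I⊆)) 0≤q

  -- Otherwise the later of the two starts lies in both intervals; positive length ensures that an
  -- interval contains its own start.
  disjoint⇒separated : ∀ {s q t r} → 0# ≤ q → 0# ≤ r → q ≢ 0# → r ≢ 0# →
    Disjoint (s , q) (t , r) → s + q ≤ t ⊎ t + r ≤ s
  disjoint⇒separated {s} {q} {t} {r} 0≤q 0≤r q≢0 r≢0 disj with s + q ≤? t | t + r ≤? s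
  ... | yes s+q≤t | _         = inj₁ s+q≤t
  ... | no _      | yes t+r≤s = inj₂ t+r≤s
  ... | no s+q≰t  | no t+r≰s  = case ≤-total s t of λ where
      (inj₁ s≤t) → contradiction ((s≤t , ≰⇒≥ s+q≰t , s+q≰t ∘ ≤-reflexive ∘ sym) , start t 0≤r r≢0) (disj t)
      (inj₂ t≤s) → contradiction (start s 0≤q q≢0 , (t≤s , ≰⇒≥ t+r≰s , t+r≰s ∘ ≤-reflexive ∘ sym)) (disj s)
    where
    start : ∀ x {y} → 0# ≤ y → y ≢ 0# → x ∈I (x , y)
    start x {y} 0≤y y≢0 = ≤-refl , x≤x+y x 0≤y ,
      λ x≡x+y → y≢0 (sym (+-cancelˡ x (trans (+-identityʳ x) x≡x+y)))

  -- A positive interval [s, s + q) cuts the window [b, e) in two.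
  weight-split : ∀ b e {s q} I → NonNegLength I → 0# ≤ q → q ≢ 0# → Disjoint (s , q) I →
    weight b e I ≤ weight b s I + weight (s + q) e I
  weight-split b e {s} {q} I@(t , r) 0≤r 0≤q q≢0 disj with weight-cases b e I
  ... | inj₁ ≡0 = ≤-trans (≤-reflexive ≡0) (+-nonNeg (weight-nonNeg b s I 0≤r) (weight-nonNeg (s + q) e I 0≤r))
  ... | inj₂ (b≤t , t+r≤e) = ≤-trans (≤-reflexive (weight-within I (b≤t , t+r≤e))) r≤
    where
    open ≤-Reasoning
    r≤ : r ≤ weight b s I + weight (s + q) e I
    r≤ with r ≟ 0#
    -- A zero-length interval may lie inside `[s, s + q)`, hence in neither part, but then it
    -- contributes nothing.
    ... | yes r≡0 = ≤-trans (≤-reflexive r≡0) (+-nonNeg (weight-nonNeg b s I 0≤r) (weight-nonNeg (s + q) e I 0≤r))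
    ... | no r≢0 with disjoint⇒separated 0≤q 0≤r q≢0 r≢0 disj
    ...   | inj₁ s+q≤t = begin
            r                                       ≡⟨ weight-within I (s+q≤t , t+r≤e) ⟨
            weight (s + q) e I                      ≤⟨ x≤x+y _ (weight-nonNeg b s I 0≤r) ⟩
            weight (s + q) e I + weight b s I       ≡⟨ +-comm _ _ ⟩
            weight b s I + weight (s + q) e I       ∎
    ...   | inj₂ t+r≤s = begin
            r                                       ≡⟨ weight-within I (b≤t , t+r≤s) ⟨
            weight b s I                            ≤⟨ x≤x+y _ (weight-nonNeg (s + q) e I 0≤r) ⟩
            weight b s I + weight (s + q) e I       ∎

  weightSum-split : ∀ b e {s q} Is → 0# ≤ q → q ≢ 0# → All NonNegLength Is → All (Disjoint (s , q)) Is →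
    weightSum b e Is ≤ weightSum b s Is + weightSum (s + q) e Is
  weightSum-split b e []       0≤q q≢0 []           []             = ≤-reflexive (sym (+-identityʳ 0#))
  weightSum-split b e (I ∷ Is) 0≤q q≢0 (0≤I ∷ 0≤Is) (disj ∷ disjs) =
    ≤-trans (+-mono-≤ (weight-split b e I 0≤I 0≤q q≢0 disj) (weightSum-split b e Is 0≤q q≢0 0≤Is disjs))
            (≤-reflexive (interchange _ _ _ _))

  -- Induction on the list, for all windows at once. A positive head inside the window cuts it into
  -- `[b, s)` and `[s + q, e)`, and the bound for the tail is applied to each part. Any other head
  -- adds nothing.
  weightSum-bound : ∀ {b e} Is → b ≤ e → All NonNegLength Is → AllPairs Disjoint Is → b + weightSum b e Is ≤ e
  weightSum-bound {b} [] b≤e [] [] = subst (_≤ _) (sym (+-identityʳ b)) b≤e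
  weightSum-bound {b} {e} (I@(s , q) ∷ Is) b≤e (0≤q ∷ 0≤Is) (disj ∷ disjs) with q ≟ 0# | weight-cases b e I
  ... | _       | inj₁ ≡0 =
    subst (λ w → b + w ≤ e) (sym (trans (cong (_+ _) ≡0) (+-identityˡ _))) (weightSum-bound Is b≤e 0≤Is disjs)
  ... | yes q≡0 | inj₂ I⊆ =
    subst (λ w → b + w ≤ e) (sym (trans (cong (_+ _) (trans (weight-within I I⊆) q≡0)) (+-identityˡ _)))
          (weightSum-bound Is b≤e 0≤Is disjs)
  ... | no q≢0  | inj₂ (b≤s , s+q≤e) = begin
    b + (weight b e I + weightSum b e Is)                            ≡⟨ cong (λ w → b + (w + _)) (weight-within I (b≤s , s+q≤e)) ⟩
    b + (q + weightSum b e Is)                                       ≤⟨ +-monoʳ-≤ b (+-monoʳ-≤ q (weightSum-split b e Is 0≤q q≢0 0≤Is disj)) ⟩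
    b + (q + (weightSum b s Is + weightSum (s + q) e Is))            ≡⟨ rearrange b q _ _ ⟩
    b + weightSum b s Is + (q + weightSum (s + q) e Is)              ≤⟨ +-monoˡ-≤ _ (weightSum-bound Is b≤s 0≤Is disjs) ⟩
    s + (q + weightSum (s + q) e Is)                                 ≡⟨ +-assoc s q _ ⟨
    s + q + weightSum (s + q) e Is                                   ≤⟨ weightSum-bound Is s+q≤e 0≤Is disjs ⟩
    e                                                                ∎
    where
    open ≤-Reasoning
    rearrange : ∀ w x y z → w + (x + (y + z)) ≡ w + y + (x + z)
    rearrange = solve 4 (λ w x y z → w ⊕ (x ⊕ (y ⊕ z)) ⊜ (w ⊕ y) ⊕ (x ⊕ z)) refl
      where open +-Solver

  totalLength : List Interval → Carrier
  totalLength = foldr (λ I → proj₂ I +_) 0#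

  weightSum-within : ∀ {b e Is} → All (Within b e) Is → weightSum b e Is ≡ totalLength Is
  weightSum-within []         = refl
  weightSum-within (I⊆ ∷ Is⊆) = cong₂ _+_ (weight-within _ I⊆) (weightSum-within Is⊆)

  disjoint⇒totalLength≤ : ∀ {e} Is → 0# ≤ e → All NonNegLength Is → All (Within 0# e) Is →
    AllPairs Disjoint Is → totalLength Is ≤ e
  disjoint⇒totalLength≤ {e} Is 0≤e 0≤Is Is⊆ disjs =
    subst (_≤ e) (trans (+-identityˡ _) (weightSum-within Is⊆)) (weightSum-bound Is 0≤e 0≤Is disjs)

  totalLength-tabulate : ∀ {n} (f : Fin n → Interval) → totalLength (tabulate f) ≡ sum (proj₂ ∘ f)
  totalLength-tabulate {zero}  f = refl
  totalLength-tabulate {suc n} f = cong (_ +_) (totalLength-tabulate (f ∘ suc))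

  totalLength-++ : ∀ Is Js → totalLength (Is ++ Js) ≡ totalLength Is + totalLength Js
  totalLength-++ []       Js = sym (+-identityˡ _)
  totalLength-++ (I ∷ Is) Js = trans (cong (_ +_) (totalLength-++ Is Js)) (sym (+-assoc _ _ _))

  -- Sums over ranges of indices

  rangeSum : (ℕ → Carrier) → ℕ → ℕ → Carrier
  rangeSum f i zero    = 0#
  rangeSum f i (suc k) = f i + rangeSum f (suc i) k

  rangeSum-snoc : ∀ f i k → rangeSum f i (suc k) ≡ rangeSum f i k + f (i ℕ.+ k)
  rangeSum-snoc f i zero    = trans (+-comm _ _) (cong (λ m → 0# + f m) (sym (ℕ.+-identityʳ i)))
  rangeSum-snoc f i (suc k) = begin
    f i + rangeSum f (suc i) (suc k)                    ≡⟨ cong (f i +_) (rangeSum-snoc f (suc i) k) ⟩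
    f i + (rangeSum f (suc i) k + f (suc i ℕ.+ k))      ≡⟨ +-assoc _ _ _ ⟨
    rangeSum f i (suc k) + f (suc i ℕ.+ k)              ≡⟨ cong (λ m → rangeSum f i (suc k) + f m) (ℕ.+-suc i k) ⟨
    rangeSum f i (suc k) + f (i ℕ.+ suc k)              ∎
    where open ≡-Reasoning

  rangeSum-cong : ∀ {f g} → (∀ m → f m ≡ g m) → ∀ i k → rangeSum f i k ≡ rangeSum g i k
  rangeSum-cong f≗g i zero    = refl
  rangeSum-cong f≗g i (suc k) = cong₂ _+_ (f≗g i) (rangeSum-cong f≗g (suc i) k)

  rangeSum-suc : ∀ f i k → rangeSum f (suc i) k ≡ rangeSum (f ∘ suc) i k
  rangeSum-suc f i zero    = refl
  rangeSum-suc f i (suc k) = cong (_ +_) (rangeSum-suc f (suc i) k)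

  module _ {f : ℕ → Carrier} (0≤f : ∀ m → 0# ≤ f m) where

    rangeSum-nonNeg : ∀ i k → 0# ≤ rangeSum f i k
    rangeSum-nonNeg i zero    = ≤-refl
    rangeSum-nonNeg i (suc k) = +-nonNeg (0≤f i) (rangeSum-nonNeg (suc i) k)

    rangeSum-mono : ∀ i {k m} → k ℕ.≤ m → rangeSum f i k ≤ rangeSum f i m
    rangeSum-mono i {m = m} z≤n = rangeSum-nonNeg i m
    rangeSum-mono i (s≤s k≤m) = +-monoʳ-≤ _ (rangeSum-mono (suc i) k≤m)

  sum-zero : ∀ {n} (g : Fin n → Carrier) → (∀ j → g j ≡ 0#) → sum g ≡ 0#
  sum-zero {n} g g≡0 = trans (sum-cong-≗ g≡0) (sum-replicate-zero n)

  -- The summand vanishes outside the window. The recursion strips the positions before `lo`, then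
  -- those of the window, shifting `f` along with `g`.
  sum-window : ∀ {n} (g : Fin n → Carrier) f lo w → lo ℕ.+ w ℕ.≤ n →
    (∀ j → lo ℕ.≤ toℕ j → toℕ j ℕ.< lo ℕ.+ w → g j ≡ f (toℕ j)) →
    (∀ j → toℕ j ℕ.< lo ⊎ lo ℕ.+ w ℕ.≤ toℕ j → g j ≡ 0#) →
    sum g ≡ rangeSum f lo w
  sum-window g f zero zero _ _ out = sum-zero g (λ j → out j (inj₂ z≤n))
  sum-window g f zero (suc w) (s≤s w≤n) in-range out =
    cong₂ _+_ (in-range zero z≤n (s≤s z≤n))
      (trans (sum-window (g ∘ suc) (f ∘ suc) zero w w≤n
                (λ j _ j<w → in-range (suc j) z≤n (s≤s j<w))
                (λ where j (inj₂ w≤j) → out (suc j) (inj₂ (s≤s w≤j))))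
             (sym (rangeSum-suc f 0 w)))
  sum-window g f (suc lo) w (s≤s ≤n) in-range out =
    trans (cong₂ _+_ (out zero (inj₁ (s≤s z≤n)))
             (trans (sum-window (g ∘ suc) (f ∘ suc) lo w ≤n
                       (λ j lo≤j j< → in-range (suc j) (s≤s lo≤j) (s≤s j<))
                       (λ where j (inj₁ j<lo) → out (suc j) (inj₁ (s≤s j<lo))
                                j (inj₂ ≤j)   → out (suc j) (inj₂ (s≤s ≤j))))
                    (sym (rangeSum-suc f lo w))))
          (+-identityˡ _)

-- Groups as index intervals, start times as prefix sums

module BlockSchedule {a ℓ : Level} (F : OrderedField a ℓ) (I : FlowShop.Instance F) where
  open OrderedField F
  open OrderedFieldProperties F
  open FlowShop F hiding (module Instance)
  open FlowShop.Instance I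

  lo width : Group → ℕ
  lo A = 0
  lo B = l
  width A = l
  width B = n ℕ.∸ l

  lo+width≤n : ∀ g → lo g ℕ.+ width g ℕ.≤ n
  lo+width≤n A = l≤n
  lo+width≤n B = ℕ.≤-reflexive (ℕ.m+[n∸m]≡n l≤n)

  group-< : ∀ j → toℕ j ℕ.< l → group j ≡ A
  group-< j j<l rewrite dec-true (toℕ j ℕ.<? l) j<l = refl

  group-≥ : ∀ j → l ℕ.≤ toℕ j → group j ≡ B
  group-≥ j l≤j rewrite dec-false (toℕ j ℕ.<? l) (ℕ.≤⇒≯ l≤j) = refl

  lo≤ : ∀ j → lo (group j) ℕ.≤ toℕ j
  lo≤ j with toℕ j ℕ.<? l
  ... | yes j<l rewrite group-< j j<l = z≤n
  ... | no  j≮l rewrite group-≥ j (ℕ.≮⇒≥ j≮l) = ℕ.≮⇒≥ j≮l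

  <lo+width : ∀ j → toℕ j ℕ.< lo (group j) ℕ.+ width (group j)
  <lo+width j with toℕ j ℕ.<? l
  ... | yes j<l rewrite group-< j j<l = j<l
  ... | no  j≮l rewrite group-≥ j (ℕ.≮⇒≥ j≮l) = subst (toℕ j ℕ.<_) (sym (ℕ.m+[n∸m]≡n l≤n)) (Fin.toℕ<n j)

  in-block⇒group : ∀ g j → lo g ℕ.≤ toℕ j → toℕ j ℕ.< lo g ℕ.+ width g → group j ≡ g
  in-block⇒group A j _   j<l = group-< j j<l
  in-block⇒group B j l≤j _   = group-≥ j l≤j

  offset : Fin n → ℕ
  offset j = toℕ j ℕ.∸ lo (group j)

  lo+offset : ∀ j → lo (group j) ℕ.+ offset j ≡ toℕ j
  lo+offset j = ℕ.m+[n∸m]≡n (lo≤ j)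

  offset<width : ∀ j → offset j ℕ.< width (group j)
  offset<width j = ℕ.+-cancelˡ-< (lo (group j)) _ _
    (subst (ℕ._< lo (group j) ℕ.+ width (group j)) (sym (lo+offset j)) (<lo+width j))

  times-toℕ : ∀ i j → times I i (toℕ j) ≡ p i j
  times-toℕ i j with toℕ j ℕ.<? n
  ... | yes j<n = cong (p i) (Fin.fromℕ<-toℕ j j<n)
  ... | no  j≮n = contradiction (Fin.toℕ<n j) j≮n

  -- The default `0#` beyond `n` makes this hold at every index, so range sums are monotone without
  -- a bound on the range.
  times-nonNeg : ∀ i m → 0# ≤ times I i m
  times-nonNeg i m with m ℕ.<? n
  ... | yes m<n = p-nonNeg i (fromℕ< m<n)
  ... | no  _   = ≤-refl

  -- Serves both kinds of sum: group loads, where `R` is membership in a group, and start offsets,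
  -- where `R` selects the earlier jobs of the same group. Either way `R` holds exactly on an index
  -- interval.
  sumOver-range : ∀ {r} {R : Pred (Fin n) r} (R? : Decidable R) i lo w → lo ℕ.+ w ℕ.≤ n →
    (∀ j → lo ℕ.≤ toℕ j → toℕ j ℕ.< lo ℕ.+ w → R j) →
    (∀ j → R j → lo ℕ.≤ toℕ j × toℕ j ℕ.< lo ℕ.+ w) →
    sumOver R? (p i) ≡ rangeSum (times I i) lo w
  sumOver-range R? i lo w ≤n to from = sum-window _ (times I i) lo w ≤n
    (λ j lo≤j j< → trans (cong (if_then p i j else 0#) (dec-true (R? j) (to j lo≤j j<))) (sym (times-toℕ i j)))
    (λ where j (inj₁ j<lo) → cong (if_then p i j else 0#) (dec-false (R? j) (ℕ.<⇒≱ j<lo ∘ proj₁ ∘ from j))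
             j (inj₂ ≤j)   → cong (if_then p i j else 0#) (dec-false (R? j) (ℕ.≤⇒≯ ≤j ∘ proj₂ ∘ from j)))

  P-rangeSum : ∀ g i → P g i ≡ rangeSum (times I i) (lo g) (width g)
  P-rangeSum g i = sumOver-range (λ j → group j ≟ᴳ g) i (lo g) (width g) (lo+width≤n g) (in-block⇒group g)
    (λ where j refl → lo≤ j , <lo+width j)

  P-nonNeg : ∀ g i → 0# ≤ P g i
  P-nonNeg g i = subst (0# ≤_) (sym (P-rangeSum g i)) (rangeSum-nonNeg (times-nonNeg i) (lo g) (width g))

  π-rangeSum : ∀ i j → π I i j ≡ blockStart I i (group j) + rangeSum (times I i) (lo (group j)) (offset j)
  π-rangeSum i j = cong (blockStart I i (group j) +_)
    (sumOver-range (λ k → (k Fin.<? j) ×-dec (group k ≟ᴳ group j)) i (lo (group j)) (offset j)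
      (subst (ℕ._≤ n) (sym (lo+offset j)) (ℕ.<⇒≤ (Fin.toℕ<n j)))
      (λ k lo≤k k< → let k<j = subst (toℕ k ℕ.<_) (lo+offset j) k< in
         k<j , in-block⇒group (group j) k lo≤k (ℕ.<-trans k<j (<lo+width j)))
      (λ where k (k<j , same) → subst (λ g → lo g ℕ.≤ toℕ k) same (lo≤ k) ,
                                subst (toℕ k ℕ.<_) (sym (lo+offset j)) k<j))

  completion-rangeSum : ∀ i j → completion I (π I) i j ≡
    blockStart I i (group j) + rangeSum (times I i) (lo (group j)) (suc (offset j))
  completion-rangeSum i j = begin
    π I i j + p i j                            ≡⟨ cong₂ _+_ (π-rangeSum i j) (sym (times-toℕ i j)) ⟩
    b + S (offset j) + times I i (toℕ j)       ≡⟨ +-assoc b _ _ ⟩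
    b + (S (offset j) + times I i (toℕ j))     ≡⟨ cong (λ m → b + (S (offset j) + times I i m)) (lo+offset j) ⟨
    b + (S (offset j) + times I i (lo (group j) ℕ.+ offset j))
                                               ≡⟨ cong (b +_) (rangeSum-snoc (times I i) (lo (group j)) (offset j)) ⟨
    b + S (suc (offset j))                     ∎
    where
    open ≡-Reasoning
    b : Carrier
    b = blockStart I i (group j)
    S : ℕ → Carrier
    S = rangeSum (times I i) (lo (group j))

  blockStart≤π : ∀ i j → blockStart I i (group j) ≤ π I i j
  blockStart≤π i j = subst (blockStart I i (group j) ≤_) (sym (π-rangeSum i j))
    (x≤x+y _ (rangeSum-nonNeg (times-nonNeg i) _ (offset j)))

  completion≤blockEnd : ∀ i j → completion I (π I) i j ≤ blockStart I i (group j) + P (group j) i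
  completion≤blockEnd i j = subst₂ _≤_ (sym (completion-rangeSum i j))
    (cong (blockStart I i (group j) +_) (sym (P-rangeSum (group j) i)))
    (+-monoʳ-≤ _ (rangeSum-mono (times-nonNeg i) _ (offset<width j)))

  completion≤π : ∀ i j k → group j ≡ group k → toℕ j ℕ.< toℕ k → completion I (π I) i j ≤ π I i k
  completion≤π i j k same j<k = subst₂ _≤_ (sym (completion-rangeSum i j)) (sym (π-rangeSum i k))
    (subst (λ g → blockStart I i (group j) + S (group j) (suc (offset j)) ≤ blockStart I i g + S g (toℕ k ℕ.∸ lo g)) same
      (+-monoʳ-≤ _ (rangeSum-mono (times-nonNeg i) _ (ℕ.∸-monoˡ-< j<k (lo≤ j)))))
    where
    S : Group → ℕ → Carrier
    S g = rangeSum (times I i) (lo g)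

  π-ordered-group : ∀ i j k → j ≢ k → group j ≡ group k →
    completion I (π I) i j ≤ π I i k ⊎ completion I (π I) i k ≤ π I i j
  π-ordered-group i j k j≢k same with ℕ.<-cmp (toℕ j) (toℕ k)
  ... | tri< j<k _ _ = inj₁ (completion≤π i j k same j<k)
  ... | tri≈ _ j≡k _ = contradiction (Fin.toℕ-injective j≡k) j≢k
  ... | tri> _ _ k<j = inj₂ (completion≤π i k j (sym same) k<j)

  -- The last job of a nonempty group completes when its block ends.
  blockEnd≤makespan : ∀ g → (∀ i → P g i ≡ 0#) ⊎ (∀ i → blockStart I i g + P g i ≤ makespan I (π I))
  blockEnd≤makespan g with width g in eq
  ... | zero  = inj₁ λ i → trans (P-rangeSum g i) (cong (rangeSum (times I i) (lo g)) eq)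
  ... | suc w = inj₂ λ i → ≤-trans (≤-reflexive (end≡ i)) (≤-trans (≤max i) (foldr-max-upper _ j))
    where
    last<n : lo g ℕ.+ w ℕ.< n
    last<n = subst (ℕ._≤ n) (trans (cong (lo g ℕ.+_) eq) (ℕ.+-suc (lo g) w)) (lo+width≤n g)
    j : Fin n
    j = fromℕ< last<n
    j≡ : toℕ j ≡ lo g ℕ.+ w
    j≡ = Fin.toℕ-fromℕ< last<n
    j∈g : group j ≡ g
    j∈g = in-block⇒group g j (subst (lo g ℕ.≤_) (sym j≡) (ℕ.m≤m+n _ w))
      (subst₂ ℕ._<_ (sym j≡) (cong (lo g ℕ.+_) (sym eq)) (ℕ.+-monoʳ-< (lo g) (ℕ.n<1+n w)))
    offset≡ : toℕ j ℕ.∸ lo g ≡ w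
    offset≡ = trans (cong (ℕ._∸ lo g) j≡) (ℕ.m+n∸m≡n (lo g) w)
    width≡ : width g ≡ suc (toℕ j ℕ.∸ lo g)
    width≡ = trans eq (cong suc (sym offset≡))
    end≡ : ∀ i → blockStart I i g + P g i ≡ completion I (π I) i j
    end≡ i = begin
      blockStart I i g + P g i                                       ≡⟨ cong (blockStart I i g +_) (P-rangeSum g i) ⟩
      blockStart I i g + rangeSum (times I i) (lo g) (width g)       ≡⟨ cong (λ k → blockStart I i g + rangeSum (times I i) (lo g) k) width≡ ⟩
      blockStart I i g + rangeSum (times I i) (lo g) (suc (toℕ j ℕ.∸ lo g))
                                                                     ≡⟨ cong (λ h → blockStart I i h + rangeSum (times I i) (lo h) (suc (toℕ j ℕ.∸ lo h))) j∈g ⟨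
      blockStart I i (group j) + rangeSum (times I i) (lo (group j)) (suc (offset j))
                                                                     ≡⟨ completion-rangeSum i j ⟨
      completion I (π I) i j                                         ∎
      where open ≡-Reasoning
    ≤max : ∀ i → completion I (π I) i j ≤ max (completion I (π I) M₁ j) (completion I (π I) M₂ j)
    ≤max M₁ = max≥ˡ _ _
    ≤max M₂ = max≥ʳ _ _

  -- Lower bounds on the makespan of a feasible schedule

  module _ (S : Schedule I) where

    0≤makespan : 0# ≤ makespan I S
    0≤makespan = foldr-max-≥0 λ j → max (completion I S M₁ j) (completion I S M₂ j)

    ends-before : ∀ i i′ j k {t} → completion I S i j ≤ S i′ k → ¬ (InProcess I S i j t × InProcess I S i′ k t)
    ends-before i i′ j k end≤start ((_ , t≤end , t≢end) , (start≤t , _)) =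
      t≢end (≤-antisym t≤end (≤-trans end≤start start≤t))

    completion≤makespan : ∀ i j → completion I S i j ≤ makespan I S
    completion≤makespan i j = ≤-trans (≤max i) (foldr-max-upper _ j)
      where
      ≤max : ∀ i → completion I S i j ≤ max (completion I S M₁ j) (completion I S M₂ j)
      ≤max M₁ = max≥ˡ _ _
      ≤max M₂ = max≥ʳ _ _

    module _ (feasible : Feasible I S) where
      open Feasible feasible

      machineLoad≤makespan : ∀ i → sum (p i) ≤ makespan I S
      machineLoad≤makespan i = subst (_≤ makespan I S) (totalLength-tabulate f)
        (disjoint⇒totalLength≤ (tabulate f) 0≤makespan (All.tabulate⁺ (p-nonNeg i))
          (All.tabulate⁺ (λ j → start-nonNeg i j , completion≤makespan i j))
          (AllPairs.tabulate⁺ (λ {j} {k} j≢k t → machine i j k t j≢k)))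
        where
        f : Fin n → Interval
        f j = S i j , p i j

      -- The operations of one group pairwise exclude each other: on the same machine by `machine`,
      -- for different jobs on different machines by `conflict`, and for the two operations of one
      -- job by `flow`.
      groupLoad≤makespan : ∀ g → P g M₁ + P g M₂ ≤ makespan I S
      groupLoad≤makespan g = subst (_≤ makespan I S)
        (trans (totalLength-++ (tabulate (f M₁)) _)
          (cong₂ _+_ (totalLength-tabulate (f M₁)) (totalLength-tabulate (f M₂))))
        (disjoint⇒totalLength≤ (tabulate (f M₁) ++ tabulate (f M₂)) 0≤makespan
          (All.++⁺ (All.tabulate⁺ (nonNeg M₁)) (All.tabulate⁺ (nonNeg M₂)))
          (All.++⁺ (All.tabulate⁺ (within M₁)) (All.tabulate⁺ (within M₂)))
          (AllPairs.++⁺ (AllPairs.tabulate⁺ (disjoint M₁)) (AllPairs.tabulate⁺ (disjoint M₂))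
            (All.tabulate⁺ λ j → All.tabulate⁺ λ k → across j k)))
        where
        -- Jobs outside the group keep their start but get length zero. The list then ranges over
        -- all jobs, its total is the group load, and the empty intervals are disjoint from
        -- everything.
        f : Machine → Fin n → Interval
        f i j = S i j , (if does (group j ≟ᴳ g) then p i j else 0#)
        nonNeg : ∀ i j → NonNegLength (f i j)
        nonNeg i j with does (group j ≟ᴳ g)
        ... | true  = p-nonNeg i j
        ... | false = ≤-refl
        within : ∀ i j → Within 0# (makespan I S) (f i j)
        within i j with does (group j ≟ᴳ g)
        ... | true  = start-nonNeg i j , completion≤makespan i j
        ... | false = start-nonNeg i j , ≤-trans (+-monoʳ-≤ _ (p-nonNeg i j)) (completion≤makespan i j)
        disjoint : ∀ i {j k} → j ≢ k → Disjoint (f i j) (f i k)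
        disjoint i {j} {k} j≢k t with does (group j ≟ᴳ g) | does (group k ≟ᴳ g)
        ... | true  | true  = machine i j k t j≢k
        ... | false | _     = ∈I-zeroLength ∘ proj₁
        ... | true  | false = ∈I-zeroLength ∘ proj₂
        across : ∀ j k → Disjoint (f M₁ j) (f M₂ k)
        across j k t with group j ≟ᴳ g | group k ≟ᴳ g
        ... | no _    | _       = ∈I-zeroLength ∘ proj₁
        ... | yes _   | no _    = ∈I-zeroLength ∘ proj₂
        ... | yes j∈g | yes k∈g with j Fin.≟ k
        ...   | yes refl = ends-before M₁ M₂ j j (flow j)
        ...   | no j≢k   = conflict j k t (j≢k , trans j∈g (sym k∈g))

  P-total : ∀ {X Y} → X ≢ Y → ∀ i → P X i + P Y i ≡ sum (p i)
  P-total {X} {Y} X≢Y i = trans (sym (∑-distrib-+ (f X) (f Y))) (sum-cong-≗ λ j → pointwise j X Y X≢Y)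
    where
    f : Group → Fin n → Carrier
    f g j = if does (group j ≟ᴳ g) then p i j else 0#
    pointwise : ∀ j X Y → X ≢ Y → f X j + f Y j ≡ p i j
    pointwise j X Y X≢Y with group j
    pointwise j A A X≢Y | _ = contradiction refl X≢Y
    pointwise j B B X≢Y | _ = contradiction refl X≢Y
    pointwise j A B X≢Y | A = +-identityʳ _
    pointwise j A B X≢Y | B = +-identityˡ _
    pointwise j B A X≢Y | A = +-identityˡ _
    pointwise j B A X≢Y | B = +-identityʳ _

  -- Feasibility, makespan and ratio of the block schedule

  -- With `X` and `Y` as variables, the start times and the comparison of minima have the same form
  -- for both group orders, so each argument is given once.
  record Arrangement (X Y : Group) : Set (a ⊔ ℓ) where
    field
      distinct : X ≢ Y
      covers   : ∀ g → g ≡ X ⊎ g ≡ Y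
      start₁X  : blockStart I M₁ X ≡ 0#
      start₁Y  : blockStart I M₁ Y ≡ P X M₁
      start₂X  : blockStart I M₂ X ≡ P X M₁
      start₂Y  : blockStart I M₂ Y ≡ P X M₁ + max (P X M₂) (P Y M₁)
      min≤min  : min (P X M₁) (P Y M₂) ≤ min (P Y M₁) (P X M₂)

  arrangement-≡ : ∀ {X Y} → groupOrder I ≡ (X , Y) → X ≢ Y → (∀ g → g ≡ X ⊎ g ≡ Y) →
    min (P X M₁) (P Y M₂) ≤ min (P Y M₁) (P X M₂) → Arrangement X Y
  arrangement-≡ {X} {Y} eq X≢Y covers min≤min = record
    { distinct = X≢Y ; covers = covers ; min≤min = min≤min
    ; start₁X = start₁X eq ; start₁Y = start₁Y eq X≢Y ; start₂X = start₂X eq ; start₂Y = start₂Y eq X≢Y }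
    where
    start₁X : ∀ {X Y} → groupOrder I ≡ (X , Y) → blockStart I M₁ X ≡ 0#
    -- The test `X ≟ᴳ X` computes only once `X` is a constructor.
    start₁X {A} eq rewrite eq = refl
    start₁X {B} eq rewrite eq = refl
    start₂X : ∀ {X Y} → groupOrder I ≡ (X , Y) → blockStart I M₂ X ≡ P X M₁
    start₂X {A} eq rewrite eq = refl
    start₂X {B} eq rewrite eq = refl
    start₁Y : ∀ {X Y} → groupOrder I ≡ (X , Y) → X ≢ Y → blockStart I M₁ Y ≡ P X M₁
    start₁Y {X} {Y} eq X≢Y rewrite eq | dec-false (Y ≟ᴳ X) (X≢Y ∘ sym) = refl
    start₂Y : ∀ {X Y} → groupOrder I ≡ (X , Y) → X ≢ Y → blockStart I M₂ Y ≡ P X M₁ + max (P X M₂) (P Y M₁)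
    start₂Y {X} {Y} eq X≢Y rewrite eq | dec-false (Y ≟ᴳ X) (X≢Y ∘ sym) = refl

  A-or-B : ∀ g → g ≡ A ⊎ g ≡ B
  A-or-B A = inj₁ refl
  A-or-B B = inj₂ refl

  -- The outcome of the comparison is kept beside the resulting order because the program branches
  -- on the same comparison and its execution needs that outcome.
  groupOrder-cases :
    (min (P A M₁) (P B M₂) ≤ min (P B M₁) (P A M₂) × groupOrder I ≡ (A , B) × Arrangement A B) ⊎
    (¬ min (P A M₁) (P B M₂) ≤ min (P B M₁) (P A M₂) × groupOrder I ≡ (B , A) × Arrangement B A)
  groupOrder-cases = case min (P A M₁) (P B M₂) ≤? min (P B M₁) (P A M₂) of λ where
    (yes h) → let eq = cong (if_then (A , B) else (B , A)) (dec-true (_ ≤? _) h) in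
      inj₁ (h , eq , arrangement-≡ eq (λ ()) A-or-B h)
    -- The failed comparison, reversed, is `min≤min` with `B` as `X` and `A` as `Y`.
    (no ¬h) → let eq = cong (if_then (A , B) else (B , A)) (dec-false (_ ≤? _) ¬h) in
      inj₂ (¬h , eq , arrangement-≡ eq (λ ()) (swap ∘ A-or-B) (≰⇒≥ ¬h))

  arrangement : Arrangement (proj₁ (groupOrder I)) (proj₂ (groupOrder I))
  arrangement = case groupOrder-cases of λ where
    (inj₁ (_ , eq , arr)) → subst (λ (X , Y) → Arrangement X Y) (sym eq) arr
    (inj₂ (_ , eq , arr)) → subst (λ (X , Y) → Arrangement X Y) (sym eq) arr

  module _ {X Y : Group} (arr : Arrangement X Y) where
    open Arrangement arr

    blockStart-nonNeg : ∀ i g → 0# ≤ blockStart I i g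
    blockStart-nonNeg i g with covers g
    blockStart-nonNeg M₁ g | inj₁ refl = ≤-reflexive (sym start₁X)
    blockStart-nonNeg M₂ g | inj₁ refl = subst (0# ≤_) (sym start₂X) (P-nonNeg X M₁)
    blockStart-nonNeg M₁ g | inj₂ refl = subst (0# ≤_) (sym start₁Y) (P-nonNeg X M₁)
    blockStart-nonNeg M₂ g | inj₂ refl = subst (0# ≤_) (sym start₂Y)
      (+-nonNeg (P-nonNeg X M₁) (≤-trans (P-nonNeg X M₂) (max≥ˡ _ _)))

    endX≤startY : ∀ i → blockStart I i X + P X i ≤ blockStart I i Y
    endX≤startY M₁ = ≤-reflexive (trans (cong (_+ P X M₁) start₁X) (trans (+-identityˡ _) (sym start₁Y)))
    endX≤startY M₂ = subst₂ _≤_ (cong (_+ P X M₂) (sym start₂X)) (sym start₂Y) (+-monoʳ-≤ _ (max≥ˡ _ _))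

    -- For `Y` the second term of the maximum enters here, as the first does in `endX≤startY`. Flow
    -- and conflict both follow: inside a group, all work on `M₁` ends before any on `M₂` begins.
    end₁≤start₂ : ∀ g → blockStart I M₁ g + P g M₁ ≤ blockStart I M₂ g
    end₁≤start₂ g with covers g
    ... | inj₁ refl = ≤-reflexive (trans (cong (_+ P X M₁) start₁X) (trans (+-identityˡ _) (sym start₂X)))
    ... | inj₂ refl = subst₂ _≤_ (cong (_+ P Y M₁) (sym start₁Y)) (sym start₂Y) (+-monoʳ-≤ _ (max≥ʳ _ _))

    completion₁≤π₂ : ∀ j k → group j ≡ group k → completion I (π I) M₁ j ≤ π I M₂ k
    completion₁≤π₂ j k same = begin
      completion I (π I) M₁ j                       ≤⟨ completion≤blockEnd M₁ j ⟩
      blockStart I M₁ (group j) + P (group j) M₁    ≤⟨ end₁≤start₂ (group j) ⟩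
      blockStart I M₂ (group j)                     ≡⟨ cong (blockStart I M₂) same ⟩
      blockStart I M₂ (group k)                     ≤⟨ blockStart≤π M₂ k ⟩
      π I M₂ k                                      ∎
      where open ≤-Reasoning

    X-before-Y : ∀ i j k → group j ≡ X → group k ≡ Y → completion I (π I) i j ≤ π I i k
    X-before-Y i j k refl refl = ≤-trans (completion≤blockEnd i j) (≤-trans (endX≤startY i) (blockStart≤π i k))

    π-ordered : ∀ i j k → j ≢ k → completion I (π I) i j ≤ π I i k ⊎ completion I (π I) i k ≤ π I i j
    π-ordered i j k j≢k with covers (group j) | covers (group k)
    ... | inj₁ j∈X | inj₁ k∈X = π-ordered-group i j k j≢k (trans j∈X (sym k∈X))
    ... | inj₁ j∈X | inj₂ k∈Y = inj₁ (X-before-Y i j k j∈X k∈Y)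
    ... | inj₂ j∈Y | inj₁ k∈X = inj₂ (X-before-Y i k j k∈X j∈Y)
    ... | inj₂ j∈Y | inj₂ k∈Y = π-ordered-group i j k j≢k (trans j∈Y (sym k∈Y))

    π-feasible : Feasible I (π I)
    π-feasible = record
      { start-nonNeg = λ i j → ≤-trans (blockStart-nonNeg i (group j)) (blockStart≤π i j)
      ; flow         = λ j → completion₁≤π₂ j j refl
      ; machine      = λ i j k t j≢k (tj , tk) → case π-ordered i j k j≢k of λ where
          (inj₁ h) → ends-before (π I) i i j k h (tj , tk)
          (inj₂ h) → ends-before (π I) i i k j h (tk , tj)
      ; conflict     = λ j k t (_ , same) → ends-before (π I) M₁ M₂ j k (completion₁≤π₂ j k same)
      }

    Cmax : Carrier
    Cmax = P X M₁ + max (P X M₂) (P Y M₁) + P Y M₂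

    0≤Cmax : 0# ≤ Cmax
    0≤Cmax = +-nonNeg (+-nonNeg (P-nonNeg X M₁) (≤-trans (P-nonNeg X M₂) (max≥ˡ _ _))) (P-nonNeg Y M₂)

    blockEnd≤Cmax : ∀ i g → blockStart I i g + P g i ≤ Cmax
    blockEnd≤Cmax M₁ g = ≤-trans (end₁≤start₂ g) (≤-trans (x≤x+y _ (P-nonNeg g M₂)) (blockEnd≤Cmax M₂ g))
    blockEnd≤Cmax M₂ g with covers g
    ... | inj₁ refl = ≤-trans (endX≤startY M₂) (≤-trans (≤-reflexive start₂Y) (x≤x+y _ (P-nonNeg Y M₂)))
    ... | inj₂ refl = ≤-reflexive (cong (_+ P Y M₂) start₂Y)

    Cmax≤makespan : Cmax ≤ makespan I (π I)
    Cmax≤makespan with blockEnd≤makespan Y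
    ... | inj₂ end≤ = subst (_≤ makespan I (π I)) (cong (_+ P Y M₂) start₂Y) (end≤ M₂)
    -- With `Y` empty the maximum collapses to `P X M₂`, and the block of `X` on `M₂` ends at
    -- `Cmax`. With both groups empty `Cmax` is zero.
    ... | inj₁ Y≡0 with blockEnd≤makespan X
    ...   | inj₂ end≤ = subst (_≤ makespan I (π I)) (trans (cong (_+ P X M₂) start₂X) (sym Cmax≡)) (end≤ M₂)
      where
      Cmax≡ : Cmax ≡ P X M₁ + P X M₂
      Cmax≡ = trans (cong₂ (λ u v → P X M₁ + max (P X M₂) u + v) (Y≡0 M₁) (Y≡0 M₂))
             (trans (+-identityʳ _) (cong (P X M₁ +_) (max-≥⇒≡ (P-nonNeg X M₂))))
    ...   | inj₁ X≡0 = subst (_≤ makespan I (π I)) (sym Cmax≡) (0≤makespan (π I))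
      where
      Cmax≡ : Cmax ≡ 0#
      Cmax≡ = trans (cong₂ (λ u v → u + max (P X M₂) v + P Y M₂) (X≡0 M₁) (Y≡0 M₁))
             (trans (cong₂ (λ u v → 0# + max u 0# + v) (X≡0 M₂) (Y≡0 M₂))
               (trans (+-identityʳ _) (trans (+-identityˡ _) (max-≥⇒≡ ≤-refl))))

    makespan-π : makespan I (π I) ≡ Cmax
    makespan-π = ≤-antisym
      (foldr-max-lub _ 0≤Cmax λ j → max-lub (completion≤Cmax M₁ j) (completion≤Cmax M₂ j)) Cmax≤makespan
      where
      completion≤Cmax : ∀ i j → completion I (π I) i j ≤ Cmax
      completion≤Cmax i j = ≤-trans (completion≤blockEnd i j) (blockEnd≤Cmax i (group j))

    Cmax≤3/2makespan : ∀ {S} → Feasible I S → Cmax ≤ 3/2 * makespan I S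
    Cmax≤3/2makespan {S} feasible = ≤-3/2 (+-min-glb Cmax≤T+PX₁ Cmax≤T+PY₂)
        (≤-trans (+-mono-≤ (min≤ˡ _ _) (≤-trans min≤min (min≤ʳ _ _))) (group≤T X))
      where
      T : Carrier
      T = makespan I S
      machine≤T : ∀ i → P X i + P Y i ≤ T
      machine≤T i = ≤-trans (≤-reflexive (P-total distinct i)) (machineLoad≤makespan S feasible i)
      group≤T : ∀ g → P g M₁ + P g M₂ ≤ T
      group≤T = groupLoad≤makespan S feasible
      -- Each term of the maximum pairs with `P Y M₂` in a different bound: `P X M₂` as load of
      -- machine `M₂`, `P Y M₁` as load of group `Y`. For the second inequality both pair with
      -- `P X M₁`, through group `X` and machine `M₁`.
      Cmax≤T+PX₁ : Cmax ≤ T + P X M₁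
      Cmax≤T+PX₁ = ≤-trans (≤-reflexive (trans (+-assoc (P X M₁) _ _) (+-comm (P X M₁) _)))
        (+-monoˡ-≤ (P X M₁) (+-max-lubʳ (machine≤T M₂) (group≤T Y)))
      Cmax≤T+PY₂ : Cmax ≤ T + P Y M₂
      Cmax≤T+PY₂ = +-monoˡ-≤ (P Y M₂) (+-max-lubˡ (group≤T X) (machine≤T M₁))

-- Number of jobs against number of edges

module EdgeCount {a ℓ : Level} (F : OrderedField a ℓ) (I : FlowShop.Instance F) where
  open FlowShop F using (edgeCount)
  open FlowShop.Instance I
  open BlockSchedule F I using (group-<; group-≥)

  toℕ-pred : ∀ {m} (k : Fin m) → toℕ (Fin.pred k) ≡ ℕ.pred (toℕ k)
  toℕ-pred zero    = refl
  toℕ-pred (suc k) = Fin.toℕ-inject₁ k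

  -- Consecutive indices share a group unless the larger one starts a group, which happens only at 0
  -- and at `l`.
  pred-edge : ∀ k → toℕ k ≢ 0 → toℕ k ≢ l → (Fin.pred k , k) ∈ edges
  pred-edge k k≢0 k≢l = ∈-filter⁺ (λ (i , j) → (i Fin.<? j) ×-dec adjacent? i j)
    (∈-cartesianProduct⁺ (∈-allFin (Fin.pred k)) (∈-allFin k))
    (pred<k , (ℕ.<⇒≢ pred<k ∘ cong toℕ) , same)
    where
    suc-pred : suc (toℕ (Fin.pred k)) ≡ toℕ k
    suc-pred = trans (cong suc (toℕ-pred k)) (ℕ.suc-pred (toℕ k) {{ℕ.≢-nonZero k≢0}})
    pred<k : toℕ (Fin.pred k) ℕ.< toℕ k
    pred<k = ℕ.≤-reflexive suc-pred
    same : group (Fin.pred k) ≡ group k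
    same with toℕ k ℕ.<? l
    ... | yes k<l = trans (group-< (Fin.pred k) (ℕ.<-trans pred<k k<l)) (sym (group-< k k<l))
    ... | no  k≮l = trans (group-≥ (Fin.pred k) (ℕ.s≤s⁻¹ (subst (l ℕ.<_) (sym suc-pred) l<k)))
                          (sym (group-≥ k (ℕ.<⇒≤ l<k)))
      where
      l<k : l ℕ.< toℕ k
      l<k = ℕ.≤∧≢⇒< (ℕ.≮⇒≥ k≮l) (k≢l ∘ sym)

  -- Every job is the first of its group or the upper end of an edge.
  n≤2+edgeCount : n ℕ.≤ 2 ℕ.+ edgeCount I
  n≤2+edgeCount = Fin.injective⇒≤ {f = proj₁ ∘ code} λ {j} {k} eq →
    Fin.toℕ-injective (trans (sym (proj₂ (code j))) (trans (cong decode eq) (proj₂ (code k))))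
    where
    decode : Fin (2 ℕ.+ edgeCount I) → ℕ
    decode zero          = 0
    decode (suc zero)    = l
    decode (suc (suc i)) = toℕ (proj₂ (lookup edges i))
    code : ∀ k → ∃ λ c → decode c ≡ toℕ k
    code k with toℕ k ℕ.≟ 0 | toℕ k ℕ.≟ l
    ... | yes k≡0 | _       = zero , sym k≡0
    ... | no _    | yes k≡l = suc zero , sym k≡l
    ... | no k≢0  | no k≢l  = suc (suc (Any.index e)) , cong (toℕ ∘ proj₂) (sym (lookup-index e))
      where
      e : (Fin.pred k , k) ∈ edges
      e = pred-edge k k≢0 k≢l

-- The program

[↦]-same : ∀ {v} {V : Set v} (f : ℕ → V) x u → (f [ x ↦ u ]) x ≡ u
[↦]-same f x u = cong (if_then u else f x) (dec-true (x ℕ.≟ x) refl)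

[↦]-other : ∀ {v} {V : Set v} (f : ℕ → V) {x y} u → y ≢ x → (f [ x ↦ u ]) y ≡ f y
[↦]-other f {x} {y} u y≢x = cong (if_then u else f y) (dec-false (y ℕ.≟ x) y≢x)

-- Index registers: 0 and 1 hold n and l, 2 the current job, 3 the end of the
-- current block, 4 the constant one, and 5 zero.  Data registers: 0 and 1 are
-- the accumulators, 3 holds zero.
inputArray outputArray accumulator : Machine → ℕ
inputArray M₁ = 0
inputArray M₂ = 1
outputArray M₁ = 2
outputArray M₂ = 3
accumulator M₁ = 0
accumulator M₂ = 1

-- Before a sweep these data registers hold the block starts, afterwards the
-- block ends.
register : Machine → Group → ℕ
register M₁ A = 4
register M₂ A = 5
register M₁ B = 6
register M₂ B = 7

-- The block of `A` ends at `l`, that of `B` at `n`, both held by input registers. `B` starts where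
-- the scan of `A` stopped.
endRegister : Group → ℕ
endRegister A = 1
endRegister B = 0

scanBody scan sweep middle program : Program
scanBody = store 2 2 0 ︔ load 2 0 2 ︔ addᴰ 0 0 2 ︔ store 3 2 1 ︔ load 2 1 2 ︔ addᴰ 1 1 2 ︔ addᴵ 2 2 4
scan = while 2 <ᴵ 3 loop scanBody

-- Adding data register 3 or index register 5, both zero, serves as a move.
block : Group → Program
block g = addᴵ 3 (endRegister g) 5 ︔ addᴰ 0 (register M₁ g) 3 ︔ addᴰ 1 (register M₂ g) 3 ︔ scan ︔
          addᴰ (register M₁ g) 0 3 ︔ addᴰ (register M₂ g) 1 3

sweep = constᴵ 2 0 ︔ block A ︔ block B

minᴰ maxᴰ : (u v w : ℕ) → Program
minᴰ u v w = ifᵀ v ≤ᴰ w then addᴰ u v 3 else addᴰ u w 3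
maxᴰ u v w = ifᵀ v ≤ᴰ w then addᴰ u w 3 else addᴰ u v 3

-- Replaces the loads by the block starts in place. The maximum is saved in register 10 before its
-- operands are overwritten; the load of `X` on `M₁`, which all other starts read, is cleared last.
arrange : (X Y : Group) → Program
arrange X Y = maxᴰ 10 (register M₂ X) (register M₁ Y) ︔
              addᴰ (register M₂ X) (register M₁ X) 3 ︔
              addᴰ (register M₂ Y) (register M₁ X) 10 ︔
              addᴰ (register M₁ Y) (register M₁ X) 3 ︔
              addᴰ (register M₁ X) 3 3

middle = minᴰ 8 (register M₁ A) (register M₂ B) ︔ minᴰ 9 (register M₁ B) (register M₂ A) ︔
         (ifᵀ 8 ≤ᴰ 9 then arrange A B else arrange B A)

-- The first sweep, with all block starts zero, computes the total loads; the
-- second one writes the schedule.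
program = constᴵ 4 1 ︔ sweep ︔ middle ︔ sweep

-- Seven instructions and one test per job, plus the final failing test.
scanTime : ℕ → ℕ
scanTime zero    = 1
scanTime (suc k) = suc (7 ℕ.+ scanTime k)

scanTime≡ : ∀ k → scanTime k ≡ 1 ℕ.+ 8 ℕ.* k
scanTime≡ zero    = refl
scanTime≡ (suc k) = trans (cong (8 ℕ.+_) (scanTime≡ k))
  (solve 1 (λ k → con 8 :+ (con 1 :+ con 8 :* k) := con 1 :+ con 8 :* (con 1 :+ k)) refl k)
  where open +-*-Solver

-- Execution and running time of the program

module ProgramProperties {a ℓ : Level} (F : OrderedField a ℓ) where
  open OrderedField F
  open OrderedFieldProperties F
  open FlowShop F
  open State

  minᴰ-exec : ∀ u v w {i d r} →
    Exec (minᴰ u v w) (state i d r) (state i (d [ u ↦ min (d v) (d w) + d 3 ]) r) 2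
  minᴰ-exec u v w {i} {d} {r} = case d v ≤? d w of λ where
      (yes h) → subst Result (sym (min-≤⇒≡ h)) (if-true (dec-true (d v ≤? d w) h) addᴰ)
      (no ¬h) → subst Result (sym (min-≥⇒≡ (≰⇒≥ ¬h))) (if-false (dec-false (d v ≤? d w) ¬h) addᴰ)
    where
    Result : Carrier → Set a
    Result x = Exec (minᴰ u v w) (state i d r) (state i (d [ u ↦ x + d 3 ]) r) 2

  maxᴰ-exec : ∀ u v w {i d r} →
    Exec (maxᴰ u v w) (state i d r) (state i (d [ u ↦ max (d v) (d w) + d 3 ]) r) 2
  maxᴰ-exec u v w {i} {d} {r} = case d v ≤? d w of λ where
      (yes h) → subst Result (sym (max-≤⇒≡ h)) (if-true (dec-true (d v ≤? d w) h) addᴰ)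
      (no ¬h) → subst Result (sym (max-≥⇒≡ (≰⇒≥ ¬h))) (if-false (dec-false (d v ≤? d w) ¬h) addᴰ)
    where
    Result : Carrier → Set a
    Result x = Exec (maxᴰ u v w) (state i d r) (state i (d [ u ↦ x + d 3 ]) r) 2

  -- The effect of scanning `k` jobs from index `x` on. `output-before` protects entries already
  -- written, both in the induction on `k` and for block `A` while `B` is scanned.
  record Scanned (x k : ℕ) (s s′ : State) : Set a where
    field
      idx₀           : idx s′ 0 ≡ idx s 0
      idx₁           : idx s′ 1 ≡ idx s 1
      idx₂           : idx s′ 2 ≡ x ℕ.+ k
      idx₃₊          : ∀ y → idx s′ (3 ℕ.+ y) ≡ idx s (3 ℕ.+ y)
      dat₃₊          : ∀ u → dat s′ (3 ℕ.+ u) ≡ dat s (3 ℕ.+ u)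
      accumulated    : ∀ i → dat s′ (accumulator i) ≡ dat s (accumulator i) + rangeSum (arr s (inputArray i)) x k
      input-kept     : ∀ i m → arr s′ (inputArray i) m ≡ arr s (inputArray i) m
      output-before  : ∀ i m → m ℕ.< x → arr s′ (outputArray i) m ≡ arr s (outputArray i) m
      output-written : ∀ i r → r ℕ.< k → arr s′ (outputArray i) (x ℕ.+ r) ≡
                       dat s (accumulator i) + rangeSum (arr s (inputArray i)) x r

  -- The final state is inferred from the instructions, so its components compute and the facts
  -- about one iteration hold by `refl`.
  scanBody-exec : ∀ s → ∃ λ s′ → Exec scanBody s s′ 7
  scanBody-exec s = _ , seq store (seq load (seq addᴰ (seq store (seq load (seq addᴰ addᴵ)))))

  scan-exec : ∀ k x s → idx s 2 ≡ x → idx s 3 ≡ x ℕ.+ k → idx s 4 ≡ 1 →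
    ∃ λ s′ → Exec scan s s′ (scanTime k) × Scanned x k s s′
  scan-exec zero x s x≡ end≡ one≡ =
    s , while-false (dec-false (idx s 2 ℕ.<? idx s 3) (ℕ.≤⇒≯ (ℕ.≤-reflexive end≤))) , record
    { idx₀ = refl ; idx₁ = refl ; idx₂ = trans x≡ (sym (ℕ.+-identityʳ x))
    ; idx₃₊ = λ _ → refl ; dat₃₊ = λ _ → refl
    ; accumulated = λ _ → sym (+-identityʳ _) ; input-kept = λ _ _ → refl ; output-before = λ _ _ _ → refl
    ; output-written = λ _ _ () }
    where
    end≤ : idx s 3 ≡ idx s 2
    end≤ = trans end≡ (trans (ℕ.+-identityʳ x) (sym x≡))
  scan-exec (suc k) x s x≡ end≡ one≡ =
    s″ , while-true (dec-true (idx s 2 ℕ.<? idx s 3) x<end) (proj₂ (scanBody-exec s)) exec , record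
    { idx₀ = rest.idx₀ ; idx₁ = rest.idx₁ ; idx₂ = trans rest.idx₂ (sym (ℕ.+-suc x k))
    ; idx₃₊ = rest.idx₃₊ ; dat₃₊ = rest.dat₃₊
    ; accumulated = λ i → trans (rest.accumulated i) (absorb i k)
    ; input-kept = λ i m → trans (rest.input-kept i m) (cong (λ f → f m) (array-in i))
    ; output-before = λ i m m<x → trans (rest.output-before i m (ℕ.m<n⇒m<1+n m<x))
        (trans (cong (λ f → f m) (output i))
          ([↦]-other (arr s (outputArray i)) _ λ m≡ → ℕ.<-irrefl (trans m≡ x≡) m<x))
    ; output-written = λ where
        -- This entry is written by the current iteration, and the remaining scan keeps it because
        -- its index is below `suc x`.
        i zero    _         → trans (cong (arr s″ (outputArray i)) (ℕ.+-identityʳ x))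
          (trans (rest.output-before i x (ℕ.n<1+n x))
          (trans (cong₂ (λ f y → f y) (output i) (sym x≡))
          (trans ([↦]-same (arr s (outputArray i)) _ _) (sym (+-identityʳ _)))))
        i (suc r) (s≤s r<k) → trans (cong (arr s″ (outputArray i)) (ℕ.+-suc x r))
          (trans (rest.output-written i r r<k) (absorb i r))
    }
    where
    s′ : State
    s′ = proj₁ (scanBody-exec s)
    accumulate : ∀ i → dat s′ (accumulator i) ≡ dat s (accumulator i) + arr s (inputArray i) (idx s 2)
    accumulate M₁ = refl
    accumulate M₂ = refl
    array-in : ∀ i → arr s′ (inputArray i) ≡ arr s (inputArray i)
    array-in M₁ = refl
    array-in M₂ = refl
    output : ∀ i → arr s′ (outputArray i) ≡ arr s (outputArray i) [ idx s 2 ↦ dat s (accumulator i) ]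
    output M₁ = refl
    output M₂ = refl
    x<end : idx s 2 ℕ.< idx s 3
    x<end = subst₂ ℕ._<_ (sym x≡) (sym end≡) (ℕ.m<m+n x (s≤s z≤n))
    ih : ∃ λ s″ → Exec scan s′ s″ (scanTime k) × Scanned (suc x) k s′ s″
    ih = scan-exec k (suc x) s′ (trans (cong₂ ℕ._+_ x≡ one≡) (ℕ.+-comm x 1)) (trans end≡ (ℕ.+-suc x k)) one≡
    s″ : State
    s″ = proj₁ ih
    exec : Exec scan s′ s″ (scanTime k)
    exec = proj₁ (proj₂ ih)
    module rest = Scanned (proj₂ (proj₂ ih))
    absorb : ∀ i r → dat s′ (accumulator i) + rangeSum (arr s′ (inputArray i)) (suc x) r ≡
      dat s (accumulator i) + rangeSum (arr s (inputArray i)) x (suc r)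
    absorb i r = trans (cong₂ (λ u f → u + rangeSum f (suc x) r)
        (trans (accumulate i) (cong (λ y → dat s (accumulator i) + arr s (inputArray i) y) x≡)) (array-in i))
      (+-assoc _ _ _)

  enter leave : Group → State → State
  enter g s = state (idx s [ 3 ↦ idx s (endRegister g) ℕ.+ idx s 5 ]) (d [ 1 ↦ d (register M₂ g) + d 3 ]) (arr s)
    where
    d : ℕ → Carrier
    d = dat s [ 0 ↦ dat s (register M₁ g) + dat s 3 ]
  leave g s = state (idx s) (d [ register M₂ g ↦ d 1 + d 3 ]) (arr s)
    where
    d : ℕ → Carrier
    d = dat s [ register M₁ g ↦ dat s 0 + dat s 3 ]

  enter-accumulator : ∀ g i s → dat (enter g s) (accumulator i) ≡ dat s (register i g) + dat s 3
  enter-accumulator A M₁ s = refl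
  enter-accumulator A M₂ s = refl
  enter-accumulator B M₁ s = refl
  enter-accumulator B M₂ s = refl

  enter-register : ∀ g i h s → dat (enter g s) (register i h) ≡ dat s (register i h)
  enter-register g M₁ A s = refl
  enter-register g M₁ B s = refl
  enter-register g M₂ A s = refl
  enter-register g M₂ B s = refl

  leave-zero : ∀ g s → dat (leave g s) 3 ≡ dat s 3
  leave-zero A s = refl
  leave-zero B s = refl

  leave-register : ∀ g i s → dat (leave g s) (register i g) ≡ dat s (accumulator i) + dat s 3
  leave-register A M₁ s = refl
  leave-register A M₂ s = refl
  leave-register B M₁ s = refl
  leave-register B M₂ s = refl

  leave-other : ∀ g i h s → h ≢ g → dat (leave g s) (register i h) ≡ dat s (register i h)
  leave-other A _  A s h≢g = contradiction refl h≢g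
  leave-other B _  B s h≢g = contradiction refl h≢g
  leave-other A M₁ B s _   = refl
  leave-other A M₂ B s _   = refl
  leave-other B M₁ A s _   = refl
  leave-other B M₂ A s _   = refl

  scanned-register : ∀ {x k s s′} → Scanned x k s s′ → ∀ i h → dat s′ (register i h) ≡ dat s (register i h)
  scanned-register scanned M₁ A = Scanned.dat₃₊ scanned 1
  scanned-register scanned M₂ A = Scanned.dat₃₊ scanned 2
  scanned-register scanned M₁ B = Scanned.dat₃₊ scanned 3
  scanned-register scanned M₂ B = Scanned.dat₃₊ scanned 4

  arranged : ∀ X Y s → ∃ λ s′ → Exec (arrange X Y) s s′ 6
  arranged X Y s = _ , seq (maxᴰ-exec 10 (register M₂ X) (register M₁ Y)) (seq addᴰ (seq addᴰ (seq addᴰ addᴰ)))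

  module _ (I : Instance) where
    open Instance I
    open BlockSchedule F I

    record Ready (s : State) : Set a where
      field
        idx-n   : idx s 0 ≡ n
        idx-l   : idx s 1 ≡ l
        idx-1   : idx s 4 ≡ 1
        idx-0   : idx s 5 ≡ 0
        dat-0   : dat s 3 ≡ 0#
        arr-in  : ∀ i m → arr s (inputArray i) m ≡ times I i m

    blockTime : Group → ℕ
    blockTime g = 1 ℕ.+ (1 ℕ.+ (1 ℕ.+ (scanTime (width g) ℕ.+ (1 ℕ.+ 1))))

    record BlockDone (g : Group) (s s′ : State) : Set a where
      field
        ready   : Ready s′
        idx₂    : idx s′ 2 ≡ lo g ℕ.+ width g
        end     : ∀ i → dat s′ (register i g) ≡ dat s (register i g) + rangeSum (times I i) (lo g) (width g)
        kept    : ∀ i h → h ≢ g → dat s′ (register i h) ≡ dat s (register i h)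
        before  : ∀ i m → m ℕ.< lo g → arr s′ (outputArray i) m ≡ arr s (outputArray i) m
        written : ∀ i r → r ℕ.< width g → arr s′ (outputArray i) (lo g ℕ.+ r) ≡
                  dat s (register i g) + rangeSum (times I i) (lo g) r

    block-exec : ∀ g s → Ready s → idx s 2 ≡ lo g → ∃ λ s′ → Exec (block g) s s′ (blockTime g) × BlockDone g s s′
    block-exec g s ready x≡ = leave g s₂ , seq addᴵ (seq addᴰ (seq addᴰ (seq exec (seq addᴰ addᴰ)))) , record
      { ready = record
        { idx-n = trans scanned.idx₀ idx-n
        ; idx-l = trans scanned.idx₁ idx-l
        ; idx-1 = trans (scanned.idx₃₊ 1) idx-1
        ; idx-0 = trans (scanned.idx₃₊ 2) idx-0
        ; dat-0 = trans (leave-zero g s₂) zero₂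
        ; arr-in = λ i m → trans (scanned.input-kept i m) (arr-in i m) }
      ; idx₂ = scanned.idx₂
      ; end = λ i → trans (leave-register g i s₂) (trans (cong (dat s₂ (accumulator i) +_) zero₂) (trans (+-identityʳ _)
          (trans (scanned.accumulated i) (sum≡ i (width g)))))
      ; kept = λ i h h≢g → trans (leave-other g i h s₂ h≢g)
          (trans (scanned-register (proj₂ (proj₂ scanResult)) i h) (enter-register g i h s))
      ; before = scanned.output-before
      ; written = λ i r r< → trans (scanned.output-written i r r<) (sum≡ i r) }
      where
      open Ready ready
      end≡ : idx (enter g s) 3 ≡ lo g ℕ.+ width g
      end≡ = trans (cong₂ ℕ._+_ (endRegister≡ g) idx-0) (ℕ.+-identityʳ _)
        where
        endRegister≡ : ∀ g → idx s (endRegister g) ≡ lo g ℕ.+ width g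
        endRegister≡ A = idx-l
        endRegister≡ B = trans idx-n (sym (ℕ.m+[n∸m]≡n l≤n))
      scanResult : ∃ λ s₂ → Exec scan (enter g s) s₂ (scanTime (width g)) × Scanned (lo g) (width g) (enter g s) s₂
      scanResult = scan-exec (width g) (lo g) (enter g s) x≡ end≡ idx-1
      s₂ : State
      s₂ = proj₁ scanResult
      exec : Exec scan (enter g s) s₂ (scanTime (width g))
      exec = proj₁ (proj₂ scanResult)
      module scanned = Scanned (proj₂ (proj₂ scanResult))
      zero₂ : dat s₂ 3 ≡ 0#
      zero₂ = trans (scanned.dat₃₊ 0) dat-0
      sum≡ : ∀ i r → dat (enter g s) (accumulator i) + rangeSum (arr s (inputArray i)) (lo g) r ≡
        dat s (register i g) + rangeSum (times I i) (lo g) r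
      sum≡ i r = cong₂ _+_
        (trans (enter-accumulator g i s) (trans (cong (dat s (register i g) +_) dat-0) (+-identityʳ _)))
        (rangeSum-cong (arr-in i) (lo g) r)

    sweepTime : ℕ
    sweepTime = 1 ℕ.+ (blockTime A ℕ.+ blockTime B)

    record Swept (s s′ : State) : Set a where
      field
        ready  : Ready s′
        loads  : ∀ i g → dat s′ (register i g) ≡ dat s (register i g) + P g i
        starts : ∀ i j → arr s′ (outputArray i) (toℕ j) ≡
                 dat s (register i (group j)) + rangeSum (times I i) (lo (group j)) (offset j)

    sweep-exec : ∀ s → Ready s → ∃ λ s′ → Exec sweep s s′ sweepTime × Swept s s′
    sweep-exec s ready = s₂ , seq constᴵ (seq (proj₁ (proj₂ resultA)) (proj₁ (proj₂ resultB))) , record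
      { ready = doneB.ready
      ; loads = λ where
          i A → trans (doneB.kept i A λ ()) (trans (doneA.end i) (cong (dat s (register i A) +_) (sym (P-rangeSum A i))))
          i B → trans (doneB.end i) (cong₂ _+_ (doneA.kept i B λ ()) (sym (P-rangeSum B i)))
      ; starts = λ i j → trans (cong (arr s₂ (outputArray i)) (sym (lo+offset j)))
          (written (group j) i (offset j) (offset<width j)) }
      where
      s₀ : State
      s₀ = state (idx s [ 2 ↦ 0 ]) (dat s) (arr s)
      resultA : ∃ λ s₁ → Exec (block A) s₀ s₁ (blockTime A) × BlockDone A s₀ s₁
      -- Only index register 2 has changed, so each field of `Ready` for `s` also has the type
      -- required for `s₀`.
      resultA = block-exec A s₀ (record { Ready ready }) refl
      s₁ : State
      s₁ = proj₁ resultA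
      module doneA = BlockDone (proj₂ (proj₂ resultA))
      resultB : ∃ λ s₂ → Exec (block B) s₁ s₂ (blockTime B) × BlockDone B s₁ s₂
      resultB = block-exec B s₁ doneA.ready doneA.idx₂
      s₂ : State
      s₂ = proj₁ resultB
      module doneB = BlockDone (proj₂ (proj₂ resultB))
      written : ∀ g i r → r ℕ.< width g →
        arr s₂ (outputArray i) (lo g ℕ.+ r) ≡ dat s (register i g) + rangeSum (times I i) (lo g) r
      written A i r r<l = trans (doneB.before i r r<l) (doneA.written i r r<l)
      written B i r r<  = trans (doneB.written i r r<) (cong (_+ rangeSum (times I i) l r) (doneA.kept i B λ ()))

    module _ {X Y : Group} (arrangement : Arrangement X Y) (s : State) (ready : Ready s)
             (loads : ∀ i g → dat s (register i g) ≡ P g i) where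
      open Arrangement arrangement
      open Ready ready using (dat-0)

      +dat₃ : ∀ x → x + dat s 3 ≡ x
      +dat₃ x = trans (cong (x +_) dat-0) (+-identityʳ x)

      arrange-starts : ∀ s′ →
        dat s′ (register M₁ X) ≡ dat s 3 + dat s 3 →
        dat s′ (register M₁ Y) ≡ dat s (register M₁ X) + dat s 3 →
        dat s′ (register M₂ X) ≡ dat s (register M₁ X) + dat s 3 →
        dat s′ (register M₂ Y) ≡ dat s (register M₁ X) + (max (dat s (register M₂ X)) (dat s (register M₁ Y)) + dat s 3) →
        ∀ i g → dat s′ (register i g) ≡ blockStart I i g
      arrange-starts s′ ₁X ₁Y ₂X ₂Y i g with covers g
      arrange-starts s′ ₁X ₁Y ₂X ₂Y M₁ g | inj₁ refl = trans ₁X (trans (+dat₃ _) (trans dat-0 (sym start₁X)))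
      arrange-starts s′ ₁X ₁Y ₂X ₂Y M₁ g | inj₂ refl = trans ₁Y (trans (+dat₃ _) (trans (loads M₁ X) (sym start₁Y)))
      arrange-starts s′ ₁X ₁Y ₂X ₂Y M₂ g | inj₁ refl = trans ₂X (trans (+dat₃ _) (trans (loads M₁ X) (sym start₂X)))
      arrange-starts s′ ₁X ₁Y ₂X ₂Y M₂ g | inj₂ refl = trans ₂Y (trans
        (cong₂ _+_ (loads M₁ X) (trans (+dat₃ _) (cong₂ max (loads M₂ X) (loads M₁ Y)))) (sym start₂Y))

    arrange-exec : ∀ {X Y} → Arrangement X Y → ∀ s → Ready s → (∀ i g → dat s (register i g) ≡ P g i) →
      ∃ λ s′ → Exec (arrange X Y) s s′ 6 × Ready s′ × (∀ i g → dat s′ (register i g) ≡ blockStart I i g)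
    arrange-exec {A} {A} arr _ _ _ = contradiction refl (Arrangement.distinct arr)
    arrange-exec {B} {B} arr _ _ _ = contradiction refl (Arrangement.distinct arr)
    -- Concrete groups give concrete register numbers, so the four register equations hold by
    -- computation.
    arrange-exec {A} {B} arr s ready loads = let s′ , exec = arranged A B s in
      s′ , exec , record { Ready ready } , arrange-starts arr s ready loads s′ refl refl refl refl
    arrange-exec {B} {A} arr s ready loads = let s′ , exec = arranged B A s in
      s′ , exec , record { Ready ready } , arrange-starts arr s ready loads s′ refl refl refl refl

    middle-exec : ∀ s → Ready s → (∀ i g → dat s (register i g) ≡ P g i) →
      ∃ λ s′ → Exec middle s s′ 11 × Ready s′ × (∀ i g → dat s′ (register i g) ≡ blockStart I i g)
    middle-exec s ready loads = case groupOrder-cases of λ where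
        (inj₁ (h , _ , arr)) → let s₂ , exec , rest = arrange-exec arr s₁ (record { Ready ready }) loads₁ in
          s₂ , seq (minᴰ-exec 8 4 7) (seq (minᴰ-exec 9 6 5) (if-true (dec-true (dat s₁ 8 ≤? dat s₁ 9)
            (subst₂ _≤_ (sym value₈) (sym value₉) h)) exec)) , rest
        (inj₂ (¬h , _ , arr)) → let s₂ , exec , rest = arrange-exec arr s₁ (record { Ready ready }) loads₁ in
          s₂ , seq (minᴰ-exec 8 4 7) (seq (minᴰ-exec 9 6 5) (if-false (dec-false (dat s₁ 8 ≤? dat s₁ 9)
            (¬h ∘ subst₂ _≤_ value₈ value₉)) exec)) , rest
      where
      open Ready ready using (dat-0)
      d : ℕ → Carrier
      d = dat s [ 8 ↦ min (dat s 4) (dat s 7) + dat s 3 ]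
      s₁ : State
      s₁ = state (idx s) (d [ 9 ↦ min (d 6) (d 5) + d 3 ]) (arr s)
      value₈ : dat s₁ 8 ≡ min (P A M₁) (P B M₂)
      value₈ = trans (cong (min (dat s 4) (dat s 7) +_) dat-0) (trans (+-identityʳ _) (cong₂ min (loads M₁ A) (loads M₂ B)))
      value₉ : dat s₁ 9 ≡ min (P B M₁) (P A M₂)
      value₉ = trans (cong (min (d 6) (d 5) +_) dat-0) (trans (+-identityʳ _) (cong₂ min (loads M₁ B) (loads M₂ A)))
      loads₁ : ∀ i g → dat s₁ (register i g) ≡ P g i
      loads₁ M₁ A = loads M₁ A
      loads₁ M₁ B = loads M₁ B
      loads₁ M₂ A = loads M₂ A
      loads₁ M₂ B = loads M₂ B

    programTime : ℕ
    programTime = 1 ℕ.+ (sweepTime ℕ.+ (11 ℕ.+ sweepTime))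

    program-exec : Outputs I program (π I) programTime
    program-exec = s₃ , seq constᴵ (seq (proj₁ (proj₂ sweep₁)) (seq (proj₁ (proj₂ mid)) (proj₁ (proj₂ sweep₂)))) ,
        λ j → output M₁ j , output M₂ j
      where
      s₀ : State
      s₀ = state (idx (input I) [ 4 ↦ 1 ]) (dat (input I)) (arr (input I))
      ready₀ : Ready s₀
      ready₀ = record
        { idx-n = refl ; idx-l = refl ; idx-1 = refl ; idx-0 = refl ; dat-0 = refl
        ; arr-in = λ where M₁ _ → refl
                           M₂ _ → refl }
      sweep₁ : ∃ λ s₁ → Exec sweep s₀ s₁ sweepTime × Swept s₀ s₁
      sweep₁ = sweep-exec s₀ ready₀
      module swept₁ = Swept (proj₂ (proj₂ sweep₁))
      mid : ∃ λ s₂ → Exec middle (proj₁ sweep₁) s₂ 11 × Ready s₂ × (∀ i g → dat s₂ (register i g) ≡ blockStart I i g)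
      -- The first sweep starts from registers holding zero, so afterwards they hold the bare loads.
      mid = middle-exec (proj₁ sweep₁) swept₁.ready λ i g → trans (swept₁.loads i g) (+-identityˡ _)
      s₂ : State
      s₂ = proj₁ mid
      sweep₂ : ∃ λ s₃ → Exec sweep s₂ s₃ sweepTime × Swept s₂ s₃
      sweep₂ = sweep-exec s₂ (proj₁ (proj₂ (proj₂ mid)))
      s₃ : State
      s₃ = proj₁ sweep₂
      output : ∀ i j → arr s₃ (outputArray i) (toℕ j) ≡ π I i j
      output i j = trans (Swept.starts (proj₂ (proj₂ sweep₂)) i j)
        (trans (cong (_+ rangeSum (times I i) (lo (group j)) (offset j)) (proj₂ (proj₂ (proj₂ mid)) i (group j)))
          (sym (π-rangeSum i j)))

    -- Each of the two sweeps costs 8 per job and 13 besides; the middle part adds 11 and the first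
    -- instruction 1.
    programTime≡ : programTime ≡ 38 ℕ.+ 16 ℕ.* n
    programTime≡ = begin
      programTime                                       ≡⟨ cong₂ time (scanTime≡ l) (scanTime≡ (n ℕ.∸ l)) ⟩
      time (1 ℕ.+ 8 ℕ.* l) (1 ℕ.+ 8 ℕ.* (n ℕ.∸ l))      ≡⟨ collect l (n ℕ.∸ l) ⟩
      38 ℕ.+ 16 ℕ.* (l ℕ.+ (n ℕ.∸ l))                   ≡⟨ cong (λ k → 38 ℕ.+ 16 ℕ.* k) (ℕ.m+[n∸m]≡n l≤n) ⟩
      38 ℕ.+ 16 ℕ.* n                                   ∎
      where
      open ≡-Reasoning
      time : ℕ → ℕ → ℕ
      time u v = 1 ℕ.+ (S ℕ.+ (11 ℕ.+ S))
        where
        S : ℕ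
        S = 1 ℕ.+ (3 ℕ.+ (u ℕ.+ 2) ℕ.+ (3 ℕ.+ (v ℕ.+ 2)))
      collect : ∀ u v → time (1 ℕ.+ 8 ℕ.* u) (1 ℕ.+ 8 ℕ.* v) ≡ 38 ℕ.+ 16 ℕ.* (u ℕ.+ v)
      collect = solve 2 (λ u v →
          let s = con 1 :+ (con 3 :+ (con 1 :+ con 8 :* u :+ con 2) :+ (con 3 :+ (con 1 :+ con 8 :* v :+ con 2))) in
          con 1 :+ (s :+ (con 11 :+ s)) := con 38 :+ con 16 :* (u :+ v)) refl
        where open +-*-Solver

    -- Inserting `n ≤ 2 + m` raises the constant 38 to 70, which `70 * m` absorbs once `m` is at
    -- least one.
    programTime≤ : 1 ℕ.≤ edgeCount I → programTime ℕ.≤ 86 ℕ.* edgeCount I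
    programTime≤ 1≤m = begin
      programTime                          ≡⟨ programTime≡ ⟩
      38 ℕ.+ 16 ℕ.* n                      ≤⟨ ℕ.+-monoʳ-≤ 38 (ℕ.*-monoʳ-≤ 16 (EdgeCount.n≤2+edgeCount F I)) ⟩
      38 ℕ.+ 16 ℕ.* (2 ℕ.+ m)              ≡⟨ solve 1 (λ m → con 38 :+ con 16 :* (con 2 :+ m) :=
                                             con 70 :* con 1 :+ con 16 :* m) refl m ⟩
      70 ℕ.* 1 ℕ.+ 16 ℕ.* m                ≤⟨ ℕ.+-monoˡ-≤ (16 ℕ.* m) (ℕ.*-monoʳ-≤ 70 1≤m) ⟩
      70 ℕ.* m ℕ.+ 16 ℕ.* m                ≡⟨ ℕ.*-distribʳ-+ m 70 16 ⟨
      86 ℕ.* m                             ∎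
      where
      open ℕ.≤-Reasoning
      open +-*-Solver
      m : ℕ
      m = edgeCount I

  π-computable : ComputableInTimeO π edgeCount
  π-computable = program , programTime , program-exec , 86 , 1 , programTime≤

-- The comparison with every feasible schedule is meaningful without an existence proof for the
-- optimum; the inequality for `C*` is its instance at a schedule attaining `C*`.
theorem3p1 : ∀ {a ℓ} (F : OrderedField a ℓ) →
  let open OrderedField F
      open FlowShop F
  in
  (∀ (I : Instance) →
    let open Instance I
        X = proj₁ (groupOrder I)
        Y = proj₂ (groupOrder I)
        C = P X M₁ + max (P X M₂) (P Y M₁) + P Y M₂
    in
    Feasible I (π I)
    × makespan I (π I) ≡ C
    × (∀ C* → IsOptimalMakespan I C* → C ≤ 3/2 * C*)
    × (∀ S → Feasible I S → C ≤ 3/2 * makespan I S))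
  × ComputableInTimeO π edgeCount
theorem3p1 F =
    (λ I →
      let open BlockSchedule F I in
      π-feasible arrangement
      , makespan-π arrangement
      , (λ { C* ((S , feasible , refl) , _) → Cmax≤3/2makespan arrangement feasible })
      , (λ S → Cmax≤3/2makespan arrangement))
  , ProgramProperties.π-computable F
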